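{- Let $G$ be a graph with $\operatorname{diam}(G)=2$ and order $n(G)$. Then $$\gamma_g(G)\le \left\lceil \frac{n(G)}{2}\right\rceil .$$ Moreover, equality holds if and only if $G$ is isomorphic to one of the following eight graphs: (1) the cycle $C_4$; (2) the cycle $C_5$; (3) the complete bipartite graph $K_{3,3}$; (4) the triangular prism (two disjoint triangles $a_0a_1a_2$ and $b_0b_1b_2$ together with the edges $a_0b_0,a_1b_1,a_2b_2$); (5) the graph on $\{u_0,\dots,u_5\}$ with edges $u_0u_1,u_1u_2,u_2u_3,u_3u_4,u_4u_0,u_4u_5,u_5u_2$; (6) the graph on $\{u_0,\dots,u_5\}$ with edges $u_0u_1,u_1u_2,u_2u_3,u_3u_4,u_4u_0,u_4u_5,u_5u_2,u_1u_5$; (7) the graph on $\{u_0,\dots,u_5\}$ with edges $u_0u_1,u_1u_2,u_2u_3,u_3u_4,u_4u_0,u_4u_5,u_5u_2,u_5u_3$; (8) the Petersen graph.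
   Context: Graphs are finite, simple and undirected; $n(G)$ is the number of vertices. A vertex dominates itself and its neighbors. The domination game on a graph $G$ is played by Dominator and Staller, who alternately select vertices of $G$; each selected vertex must dominate at least one vertex not dominated by the previously selected vertices. The game ends when the selected vertices form a dominating set of $G$. Dominator aims to finish the game in as few moves as possible, Staller aims for the opposite. In the D-game Dominator makes the first move. The game domination number $\gamma_g(G)$ is the total number of vertices selected in the D-game when both players play optimally. -}

module Defs where

open import Data.Fin using (Fin; _≟_)
open import Data.Fin.Patterns
open import Data.Fin.Properties using (any?)
open import Data.List using (List; []; _∷_; map; filter; allFin; cartesianProduct)
import Data.List.Relation.Unary.Any as Any
open Any using (Any)
import Data.List.Membership.DecPropositional as DecMembership
open import Data.List.NonEmpty using (List⁺; _∷_; foldr₁)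
open import Data.Nat using (ℕ; zero; suc; _≤_; _⊓_; _⊔_)
open import Data.Product using (∃-syntax; _×_; _,_)
open import Data.Product.Properties using (≡-dec)
open import Data.Sum using (_⊎_; inj₁; inj₂; swap)
open import Function.Bundles using (_↔_; _⇔_; Inverse)
open import Level using (0ℓ)
open import Relation.Binary using (Rel; Symmetric; Decidable)
open import Relation.Binary.PropositionalEquality using (_≡_; _≢_; refl; ≢-sym)
open import Relation.Nullary using (¬_; Dec; ¬?; _×-dec_; _⊎-dec_)

-- A finite simple graph of order n.  Decidability of adjacency is automatic
-- classically; here it makes the domination game computable.
record Graph (n : ℕ) : Set₁ where
  infix 4 _~_ _~?_
  field
    _~_      : Rel (Fin n) 0ℓ
    ~-sym    : Symmetric _~_
    ~-irrefl : ∀ {u} → ¬ (u ~ u)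
    _~?_     : Decidable _~_

infix 4 _≅_
record _≅_ {m n : ℕ} (G : Graph m) (H : Graph n) : Set where
  private
    module G = Graph G
    module H = Graph H
  field
    bijection : Fin m ↔ Fin n
    adjacency : ∀ u v → u G.~ v ⇔ Inverse.to bijection u H.~ Inverse.to bijection v

module _ {n : ℕ} (G : Graph n) where
  open Graph G

  data Walk : Fin n → Fin n → ℕ → Set where
    []  : ∀ {u} → Walk u u 0
    _∷_ : ∀ {u v w k} → u ~ v → Walk v w k → Walk u w (suc k)

  -- Shortest walks are paths, so this is the usual graph distance.
  Distance : Fin n → Fin n → ℕ → Set
  Distance u v d = Walk u v d × (∀ k → Walk u v k → d ≤ k)

  -- The maximum distance exists and equals d; in particular G is connected.
  Diameter : ℕ → Set
  Diameter d = (∀ u v → ∃[ k ] (Distance u v k × k ≤ d))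
             × (∃[ u ] ∃[ v ] Distance u v d)

  Dominates : Rel (Fin n) 0ℓ
  Dominates u v = u ≡ v ⊎ u ~ v

  dominates? : Decidable Dominates
  dominates? u v = (u ≟ v) ⊎-dec (u ~? v)

  -- S lists the vertices selected so far.
  Dominated : List (Fin n) → Fin n → Set
  Dominated S v = Any (λ u → Dominates u v) S

  dominated? : Decidable Dominated
  dominated? S v = Any.any? (λ u → dominates? u v) S

  Legal : List (Fin n) → Fin n → Set
  Legal S u = ∃[ v ] (Dominates u v × ¬ Dominated S v)

  legal? : Decidable Legal
  legal? S u = any? (λ v → dominates? u v ×-dec ¬? (dominated? S v))

  legalMoves : List (Fin n) → List (Fin n)
  legalMoves S = filter (legal? S) (allFin n)

data Player : Set where
  dominator staller : Player

opponent : Player → Player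
opponent dominator = staller
opponent staller   = dominator

optimum : Player → List⁺ ℕ → ℕ
optimum dominator = foldr₁ _⊓_
optimum staller   = foldr₁ _⊔_

-- movesLeft G m p S is the number of further moves under optimal play from the
-- position S with p to move, where play is cut off after m further moves.  A
-- vertex not yet dominated is itself a legal move, so there are no legal moves
-- exactly when S is a dominating set, i.e. when the game has ended.
movesLeft : ∀ {n} → Graph n → ℕ → Player → List (Fin n) → ℕ
movesLeft G zero    p S = 0
movesLeft G (suc m) p S with legalMoves G S
... | []     = 0
... | v ∷ vs = suc (optimum p (value v ∷ map value vs))
  where
  value = λ u → movesLeft G m (opponent p) (u ∷ S)

-- Each move dominates a new vertex, so every game on n vertices ends within n
-- moves and the cut-off at n has no effect.
γg : ∀ {n} → Graph n → ℕ
γg {n} G = movesLeft G n dominator []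

fromEdges : ∀ {n} → List (Fin n × Fin n) → Graph n
fromEdges {n} E = record
  { _~_      = λ u v → u ≢ v × ((u , v) ∈ E ⊎ (v , u) ∈ E)
  ; ~-sym    = λ (u≢v , e) → ≢-sym u≢v , swap e
  ; ~-irrefl = λ (u≢u , _) → u≢u refl
  ; _~?_     = λ u v → ¬? (u ≟ v) ×-dec (((u , v) ∈? E) ⊎-dec ((v , u) ∈? E))
  }
  where open DecMembership (≡-dec (_≟_ {n}) (_≟_ {n})) using (_∈_; _∈?_)

C₄ : Graph 4
C₄ = fromEdges ((0F , 1F) ∷ (1F , 2F) ∷ (2F , 3F) ∷ (3F , 0F) ∷ [])

C₅ : Graph 5
C₅ = fromEdges ((0F , 1F) ∷ (1F , 2F) ∷ (2F , 3F) ∷ (3F , 4F) ∷ (4F , 0F) ∷ [])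

K₃,₃ : Graph 6
K₃,₃ = fromEdges (cartesianProduct (0F ∷ 1F ∷ 2F ∷ []) (3F ∷ 4F ∷ 5F ∷ []))

-- aᵢ is vertex i and bᵢ is vertex 3 + i.
prism : Graph 6
prism = fromEdges
  ( (0F , 1F) ∷ (1F , 2F) ∷ (2F , 0F)
  ∷ (3F , 4F) ∷ (4F , 5F) ∷ (5F , 3F)
  ∷ (0F , 3F) ∷ (1F , 4F) ∷ (2F , 5F) ∷ [])

-- The 5-cycle u₀u₁u₂u₃u₄ together with u₅ adjacent to u₂ and u₄.
baseEdges : List (Fin 6 × Fin 6)
baseEdges = (0F , 1F) ∷ (1F , 2F) ∷ (2F , 3F) ∷ (3F , 4F) ∷ (4F , 0F)
          ∷ (4F , 5F) ∷ (5F , 2F) ∷ []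

H₅ H₆ H₇ : Graph 6
H₅ = fromEdges baseEdges
H₆ = fromEdges ((1F , 5F) ∷ baseEdges)
H₇ = fromEdges ((5F , 3F) ∷ baseEdges)

-- Outer 5-cycle on 0–4, inner pentagram on 5–9, spokes i — 5 + i.
petersen : Graph 10
petersen = fromEdges
  ( (0F , 1F) ∷ (1F , 2F) ∷ (2F , 3F) ∷ (3F , 4F) ∷ (4F , 0F)
  ∷ (5F , 7F) ∷ (7F , 9F) ∷ (9F , 6F) ∷ (6F , 8F) ∷ (8F , 5F)
  ∷ (0F , 5F) ∷ (1F , 6F) ∷ (2F , 7F) ∷ (3F , 8F) ∷ (4F , 9F) ∷ [])

{-# OPTIONS --safe #-}
module Submission where

-- Dominator opens with a vertex of maximum degree Δ, and afterwards hits at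
-- least three undominated vertices as long as some move does.  Together with
-- Staller's reply such a round removes four vertices in two moves, which is
-- the rate n / 2.  When every move hits at most two undominated vertices, let U
-- be the set of these vertices.  Any two of them are adjacent or have a common
-- neighbour, so the neighbours of a vertex of U bring in the others one at a
-- time, and |U| ≤ Δ + 1 (spread, sparse).  From there Dominator always hits two
-- vertices and the game ends in about 2 |U| / 3 moves (rate).  The slower rate
-- loses about Δ / 6 moves, while the first move, which hits Δ + 1 vertices, saves
-- about (Δ - 2) / 2 moves.  On balance the bound is strict when Δ ≥ 5 (descend),
-- and also when Δ = 4 unless n = 10 or n = 14 (descend, descend-odd).  For n = 14
-- the positions in which the balance fails do not occur, by counting edges
-- between undominated and dominated vertices (crowd, fourteen).
--
-- If Δ ≤ 3 then n ≤ 10 by the Moore bound (moore).  The pairs (n, Δ) equal to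
-- (3, 2), (4, 3), (5, 3) and (7, 3) are immediate, and the positions that are
-- critical for (9, 3) are excluded by counting edges (stuck⇒order≢9).  For the
-- remaining pairs (4, 2), (5, 2), (6, 3), (8, 3) and (10, 3), and for the critical
-- positions of (10, 4), an exhaustive search decides adjacencies one by one,
-- pruned by the degree bound and by the distance condition (search,
-- search-sound).  A graph is brought into the searched form by a permutation that
-- matches colour classes (rearrange), and γg is invariant under isomorphism
-- (γg-cong).  In every graph found Dominator stays strictly below the bound, or
-- the graph is isomorphic to one of the eight exceptions, whose values are
-- computed by evaluating the game (γg-exact).

open import Defs
import Data.Nat.Properties as ℕₚ
open import Algebra.Properties.CommutativeMonoid.Sum ℕₚ.+-0-commutativeMonoid
  using (sum; ∑-comm; sum-permute; sum-remove)
open import Data.Bool using (Bool; true; false; T; not; _∧_; _∨_; if_then_else_)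
open import Data.Empty using (⊥-elim)
open import Data.Fin using (Fin; zero; suc; _≟_; punchIn; toℕ)
open import Data.Fin.Patterns
open import Data.Fin.Properties using (any?; all?)
open import Data.Fin.Permutation
  using (Permutation; _⟨$⟩ʳ_; _⟨$⟩ˡ_; inverseʳ; ↔⇒≡; insert; insert-punchIn)
  renaming (id to idₚ)
open import Data.List using (List; []; _∷_; map; allFin; cartesianProduct; filterᵇ; _++_)
open import Data.List.Membership.Propositional using (_∈_)
open import Data.List.Membership.Propositional.Properties using (∈-filter⁺; ∈-filter⁻; ∈-allFin)
open import Data.List.NonEmpty using (_∷_; foldr₁)
import Data.List.Relation.Unary.Any as Any
open Any using (here; there)
open import Data.List.Relation.Unary.Any.Properties using (map⁺; map⁻)
open import Data.Nat
  using (ℕ; zero; suc; _+_; _*_; _⊓_; _⊔_; _≤_; _<_; z≤n; s≤s; ⌈_/2⌉; ⌊_/2⌋; _≤?_; _<?_; _≤ᵇ_; _<ᵇ_)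
open import Data.Nat.Properties
  using ( ≤-refl; ≤-reflexive; ≤-trans; ≤-antisym; +-mono-≤; m≤m+n; m≤n+m; ≤⇒≤ᵇ
        ; m⊓n≤m; m⊓n≤n; m≤m⊔n; m≤n⊔m; ⊓-glb; ⊔-lub; module ≤-Reasoning)
open import Data.Nat.Tactic.RingSolver using (solve-∀)
open import Data.List.Relation.Unary.All using (All; []; _∷_)
open import Data.List.Relation.Unary.All.Properties using (++⁺)
  renaming (map⁺ to All-map⁺; tabulate⁺ to All-tabulate⁺)
open import Data.Maybe.Properties using (just-injective)
open import Data.Maybe as Maybe using (Maybe; just; nothing; _<∣>_)
open import Data.Product using (∃-syntax; Σ; _×_; _,_; proj₁; proj₂; swap)
open import Data.Sum using (_⊎_; inj₁; inj₂; [_,_]′)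
open import Data.Unit using (⊤; tt)
open import Data.Vec using (Vec; []; _∷_; lookup; tabulate; replicate; zipWith; _[_]%=_; _[_]≔_)
open import Data.Vec.Properties
  using ( lookup-zipWith; lookup∘tabulate; lookup-replicate
        ; lookup∘updateAt; lookup∘updateAt′; lookup∘update; lookup∘update′)
open import Function using (_∘_)
open import Function.Bundles using (_⇔_; mk↔ₛ′; mk⇔; Inverse; Equivalence)
open import Function.Properties.Inverse using (↔-sym; ↔-trans)
open import Relation.Binary.PropositionalEquality
  using (_≡_; _≢_; refl; sym; trans; cong; cong₂; subst; subst₂)
open import Relation.Nullary using (¬_; Dec; yes; no; does; _×-dec_)

-- Counting subsets of a finite set

does-T : ∀ {a} {P : Set a} (d : Dec P) → T (does d) → P
does-T (yes p) _ = p

T-does : ∀ {a} {P : Set a} (d : Dec P) → P → T (does d)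
T-does (yes _) _ = tt
T-does (no ¬p) p = ⊥-elim (¬p p)

T-not : ∀ {b} → T (not b) → ¬ T b
T-not {false} _ ()

not-T : ∀ {b} → ¬ T b → T (not b)
not-T {false} _ = tt
not-T {true} ¬t = ⊥-elim (¬t tt)

∧-intro : ∀ {a b} → T a → T b → T (a ∧ b)
∧-intro {true} _ q = q

∧-fst : ∀ {a b} → T (a ∧ b) → T a
∧-fst {true} _ = tt

∧-snd : ∀ {a b} → T (a ∧ b) → T b
∧-snd {true} q = q

T-ext : ∀ {a b} → (T a → T b) → (T b → T a) → a ≡ b
T-ext {false} {false} _ _ = refl
T-ext {false} {true}  _ g = ⊥-elim (g tt)
T-ext {true}  {false} f _ = ⊥-elim (f tt)
T-ext {true}  {true}  _ _ = refl

#_ : Bool → ℕ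
# true  = 1
# false = 0

opaque
  -- The number of elements of Fin n satisfying a Boolean predicate.
  count : ∀ {n} → (Fin n → Bool) → ℕ
  count {zero}  f = 0
  count {suc n} f = # f zero + count (f ∘ suc)

  count≡sum : ∀ {n} (f : Fin n → Bool) → count f ≡ sum (λ i → # f i)
  count≡sum {zero}  f = refl
  count≡sum {suc n} f = cong (# f zero +_) (count≡sum (f ∘ suc))

  count-cong : ∀ {n} {f g : Fin n → Bool} → (∀ i → f i ≡ g i) → count f ≡ count g
  count-cong {zero}  p = refl
  count-cong {suc n} p = cong₂ _+_ (cong #_ (p zero)) (count-cong (p ∘ suc))

  count-mono : ∀ {n} {f g : Fin n → Bool} → (∀ i → T (f i) → T (g i)) → count f ≤ count g
  count-mono {zero}          p = z≤n
  count-mono {suc n} {f} {g} p = +-mono-≤ (le (f zero) (g zero) (p zero)) (count-mono (p ∘ suc))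
    where
    le : ∀ a b → (T a → T b) → # a ≤ # b
    le false _     _ = z≤n
    le true  true  _ = ≤-refl
    le true  false q = ⊥-elim (q tt)

  count-split : ∀ {n} (f g : Fin n → Bool) →
                count f ≡ count (λ i → f i ∧ g i) + count (λ i → f i ∧ not (g i))
  count-split {zero}  f g = refl
  count-split {suc n} f g with f zero | g zero | count-split (f ∘ suc) (g ∘ suc)
  ... | false | _     | eq = eq
  ... | true  | true  | eq = cong suc eq
  ... | true  | false | eq = trans (cong suc eq) (sym (ℕₚ.+-suc _ _))

  count-none : ∀ {n} {f : Fin n → Bool} → (∀ i → ¬ T (f i)) → count f ≡ 0
  count-none {zero}  _ = refl
  count-none {suc n} {f} p with f zero in eq
  ... | true  = ⊥-elim (p zero (subst T (sym eq) tt))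
  ... | false = count-none (p ∘ suc)

  count-all : ∀ n → count {n} (λ _ → true) ≡ n
  count-all zero    = refl
  count-all (suc n) = cong suc (count-all n)

  count>0 : ∀ {n} {f : Fin n → Bool} i → T (f i) → 0 < count f
  count>0 {f = f} zero    t with true ← f zero = s≤s z≤n
  count>0 {f = f} (suc i) t = ≤-trans (count>0 i t) (m≤n+m _ (# f zero))

  count>0⇒∃ : ∀ {n} {f : Fin n → Bool} → 0 < count f → ∃[ i ] T (f i)
  count>0⇒∃ {suc n} {f} p with f zero in eq
  ... | true  = zero , subst T (sym eq) tt
  ... | false with i , t ← count>0⇒∃ {f = f ∘ suc} p = suc i , t

  count-≟ : ∀ {n} (i : Fin n) → count (λ j → does (i ≟ j)) ≡ 1
  count-≟ {suc n} zero = cong suc (count-none {n} {λ _ → false} λ _ ())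
  count-≟ (suc i) = count-≟ i

count-remove : ∀ {n} (f : Fin n → Bool) i → T (f i) →
               count f ≡ suc (count (λ j → f j ∧ not (does (i ≟ j))))
count-remove f i t = trans (count-split f (λ j → does (i ≟ j)))
  (cong (_+ count (λ j → f j ∧ not (does (i ≟ j)))) (trans (count-cong same) (count-≟ i)))
  where
  same : ∀ j → f j ∧ does (i ≟ j) ≡ does (i ≟ j)
  same j = T-ext (∧-snd {f j}) λ e → ∧-intro (subst (T ∘ f) (does-T (i ≟ j) e) t) e

opaque
  unfolding count

  count-*-≤ : ∀ {n} {f : Fin n → Bool} {t : Fin n → ℕ} {m} →
              (∀ i → T (f i) → m ≤ t i) → count f * m ≤ sum t
  count-*-≤ {zero}  _ = z≤n
  count-*-≤ {suc n} {f} {t} p with f zero in eq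
  ... | true  = +-mono-≤ (p zero (subst T (sym eq) tt)) (count-*-≤ (p ∘ suc))
  ... | false = ≤-trans (count-*-≤ {t = t ∘ suc} (p ∘ suc)) (m≤n+m _ (t zero))

  sum-≤-count-* : ∀ {n} {f : Fin n → Bool} {t : Fin n → ℕ} {h} →
                  (∀ i → T (f i) → t i ≤ h) → (∀ i → ¬ T (f i) → t i ≡ 0) →
                  sum t ≤ count f * h
  sum-≤-count-* {zero}  _ _ = z≤n
  sum-≤-count-* {suc n} {f} {t} p q with f zero in eq
  ... | true  = +-mono-≤ (p zero (subst T (sym eq) tt)) (sum-≤-count-* (p ∘ suc) (q ∘ suc))
  ... | false rewrite q zero (subst (¬_ ∘ T) (sym eq) (λ ())) = sum-≤-count-* (p ∘ suc) (q ∘ suc)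

-- If every element of f is related to at least k elements of g, and every
-- element of g to at most h elements of f, then |f| k ≤ |g| h.
double-count : ∀ {m n} {f : Fin m → Bool} {g : Fin n → Bool} (r : Fin n → Fin m → Bool) {k h} →
  (∀ x → T (f x) → k ≤ count (λ z → g z ∧ r z x)) →
  (∀ z → T (g z) → count (λ x → f x ∧ r z x) ≤ h) →
  count f * k ≤ count g * h
double-count {f = f} {g} r {k} {h} lower upper = begin
  count f * k                                            ≤⟨ count-*-≤ rows ⟩
  sum (λ x → sum (λ z → # (g z ∧ (f x ∧ r z x))))        ≡⟨ ∑-comm (λ x z → # (g z ∧ (f x ∧ r z x))) ⟩
  sum (λ z → sum (λ x → # (g z ∧ (f x ∧ r z x))))        ≤⟨ sum-≤-count-* cols none ⟩
  count g * h                                            ∎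
  where
  open ≤-Reasoning
  rows : ∀ x → T (f x) → k ≤ sum (λ z → # (g z ∧ (f x ∧ r z x)))
  rows x t = ≤-trans (lower x t) (≤-trans
    (count-mono λ z u → ∧-intro {g z} (∧-fst u) (∧-intro {f x} t (∧-snd {g z} u)))
    (≤-reflexive (count≡sum _)))
  cols : ∀ z → T (g z) → sum (λ x → # (g z ∧ (f x ∧ r z x))) ≤ h
  cols z t = ≤-trans (≤-reflexive (sym (count≡sum _)))
    (≤-trans (count-mono λ x u → ∧-snd {g z} u) (upper z t))
  none : ∀ z → ¬ T (g z) → sum (λ x → # (g z ∧ (f x ∧ r z x))) ≡ 0
  none z ¬t = trans (sym (count≡sum (λ x → g z ∧ (f x ∧ r z x)))) (count-none (λ x u → ¬t (∧-fst {g z} u)))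

-- The game as a game on sets of undominated vertices

module _ {A : Set} (f : A → ℕ) where

  min-≤ : ∀ v vs {x} → x ∈ v ∷ vs → foldr₁ _⊓_ (f v ∷ map f vs) ≤ f x
  min-≤ v []       (here refl) = ≤-refl
  min-≤ v (w ∷ vs) (here refl) = m⊓n≤m _ _
  min-≤ v (w ∷ vs) (there x∈)  = ≤-trans (m⊓n≤n (f v) _) (min-≤ w vs x∈)

  ≤-min : ∀ v vs {k} → (∀ {x} → x ∈ v ∷ vs → k ≤ f x) → k ≤ foldr₁ _⊓_ (f v ∷ map f vs)
  ≤-min v []       p = p (here refl)
  ≤-min v (w ∷ vs) p = ⊓-glb (p (here refl)) (≤-min w vs (p ∘ there))

  ≤-max : ∀ v vs {x} → x ∈ v ∷ vs → f x ≤ foldr₁ _⊔_ (f v ∷ map f vs)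
  ≤-max v []       (here refl) = ≤-refl
  ≤-max v (w ∷ vs) (here refl) = m≤m⊔n _ _
  ≤-max v (w ∷ vs) (there x∈)  = ≤-trans (≤-max w vs x∈) (m≤n⊔m (f v) _)

  max-≤ : ∀ v vs {k} → (∀ {x} → x ∈ v ∷ vs → f x ≤ k) → foldr₁ _⊔_ (f v ∷ map f vs) ≤ k
  max-≤ v []       p = p (here refl)
  max-≤ v (w ∷ vs) p = ⊔-lub (p (here refl)) (max-≤ w vs (p ∘ there))

-- A position of the game is represented by its set of undominated vertices.
State : ℕ → Set
State n = Fin n → Bool

module Game {n : ℕ} (G : Graph n) where
  open Graph G

  -- cl u is the closed neighbourhood of u.
  cl : Fin n → Fin n → Bool
  cl u v = does (dominates? G u v)

  infixl 6 _⊖_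
  -- The undominated vertices left after v has been selected.
  _⊖_ : State n → Fin n → State n
  (U ⊖ v) x = U x ∧ not (cl v x)

  -- The number of vertices newly dominated by v; the move v is legal when
  -- this is positive.
  hits : Fin n → State n → ℕ
  hits v U = count λ x → U x ∧ cl v x

  size-⊖ : ∀ U v → count U ≡ hits v U + count (U ⊖ v)
  size-⊖ U v = count-split U (cl v)

  -- Finish p k U: with p to move, Dominator can end the game within k moves.
  Finish : Player → ℕ → State n → Set
  Finish p         zero    U = count U ≡ 0
  Finish dominator (suc k) U = count U ≡ 0 ⊎ ∃[ v ] (0 < hits v U × Finish staller k (U ⊖ v))
  Finish staller   (suc k) U = ∀ v → 0 < hits v U → Finish dominator k (U ⊖ v)

  -- Force p k U: with p to move, Staller can make the game last k moves.
  Force : Player → ℕ → State n → Set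
  Force p         zero    U = ⊤
  Force dominator (suc k) U = 0 < count U × (∀ v → 0 < hits v U → Force staller k (U ⊖ v))
  Force staller   (suc k) U = ∃[ v ] (0 < hits v U × Force dominator k (U ⊖ v))

  -- The state reached after the moves S.
  undominated : List (Fin n) → State n
  undominated []      = λ _ → true
  undominated (u ∷ S) = undominated S ⊖ u

  undominated⇒ : ∀ S {x} → T (undominated S x) → ¬ Dominated G S x
  undominated⇒ (u ∷ S) t (here d)  =
    T-not (∧-snd {undominated S _} t) (T-does (dominates? G u _) d)
  undominated⇒ (u ∷ S) t (there d) = undominated⇒ S (∧-fst t) d

  undominated⇐ : ∀ S {x} → ¬ Dominated G S x → T (undominated S x)
  undominated⇐ []      _ = tt
  undominated⇐ (u ∷ S) ¬d = ∧-intro {undominated S _} (undominated⇐ S (¬d ∘ there))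
    (not-T (¬d ∘ here ∘ does-T (dominates? G u _)))

  legal⇒hits : ∀ S {v} → Legal G S v → 0 < hits v (undominated S)
  legal⇒hits S {v} (x , d , ¬d) =
    count>0 x (∧-intro {undominated S x} (undominated⇐ S ¬d) (T-does (dominates? G v x) d))

  hits⇒legal : ∀ S {v} → 0 < hits v (undominated S) → Legal G S v
  hits⇒legal S {v} h with x , t ← count>0⇒∃ h =
    x , does-T (dominates? G v x) (∧-snd {undominated S x} t) , undominated⇒ S (∧-fst t)

  hits⇒size : ∀ {U v} → 0 < hits v U → 0 < count U
  hits⇒size {U} {v} h = ≤-trans h (≤-trans (m≤m+n _ _) (≤-reflexive (sym (size-⊖ U v))))

  cl-refl : ∀ x → T (cl x x)
  cl-refl x = T-does (dominates? G x x) (inj₁ refl)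

  -- Once v is selected, v itself dominates nothing new.
  fresh : ∀ {U v w} → 0 < hits w (U ⊖ v) → v ≢ w
  fresh {U} {v} h refl with x , t ← count>0⇒∃ h =
    T-not (∧-snd {U x} (∧-fst t)) (∧-snd {(U ⊖ v) x} t)

  self-hits : ∀ {U x} → T (U x) → 0 < hits x U
  self-hits {U} {x} t = count>0 x (∧-intro {U x} t (cl-refl x))

  nonempty⇒hits : ∀ {U} → 0 < count U → ∃[ v ] 0 < hits v U
  nonempty⇒hits {U} p with x , t ← count>0⇒∃ p = x , self-hits {U} t

  legal⇒∈ : ∀ S {v} → Legal G S v → v ∈ legalMoves G S
  legal⇒∈ S = ∈-filter⁺ (legal? G S) (∈-allFin _)

  ∈⇒legal : ∀ S {v} → v ∈ legalMoves G S → Legal G S v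
  ∈⇒legal S v∈ = proj₂ (∈-filter⁻ (legal? G S) {xs = allFin n} v∈)

  hits⇒∈ : ∀ S {v} → 0 < hits v (undominated S) → v ∈ legalMoves G S
  hits⇒∈ S = legal⇒∈ S ∘ hits⇒legal S

  ∈⇒hits : ∀ S {v} → v ∈ legalMoves G S → 0 < hits v (undominated S)
  ∈⇒hits S = legal⇒hits S ∘ ∈⇒legal S

  0<⇒≢0 : ∀ {m} → 0 < m → ¬ m ≡ 0
  0<⇒≢0 (s≤s _) ()

  -- The bound holds for every cut-off m.
  finish-sound : ∀ p k S → Finish p k (undominated S) → ∀ m → movesLeft G m p S ≤ k
  finish-sound p k S F zero = z≤n
  finish-sound p k S F (suc m) with legalMoves G S | hits⇒∈ S | ∈⇒hits S
  finish-sound p k S F (suc m) | [] | _ | _ = z≤n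
  finish-sound p zero S F (suc m) | v ∷ vs | _ | h =
    ⊥-elim (0<⇒≢0 (hits⇒size (h (here refl))) F)
  finish-sound dominator (suc k) S (inj₁ e) (suc m) | v ∷ vs | _ | h =
    ⊥-elim (0<⇒≢0 (hits⇒size (h (here refl))) e)
  finish-sound dominator (suc k) S (inj₂ (w , h , F)) (suc m) | v ∷ vs | ∈w | _ =
    s≤s (≤-trans (min-≤ _ v vs (∈w h)) (finish-sound staller k (w ∷ S) F m))
  finish-sound staller (suc k) S F (suc m) | v ∷ vs | _ | h =
    s≤s (max-≤ _ v vs λ {w} w∈ → finish-sound dominator k (w ∷ S) (F w (h w∈)) m)

  ¬∈[] : ∀ {v : Fin n} → ¬ v ∈ []
  ¬∈[] ()

  -- The cut-off m must leave room for the k moves that Staller forces.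
  force-sound : ∀ p k S → Force p k (undominated S) → ∀ m → k ≤ m → k ≤ movesLeft G m p S
  force-sound p zero S F m _ = z≤n
  force-sound p (suc k) S F (suc m) (s≤s k≤m) with legalMoves G S | hits⇒∈ S | ∈⇒hits S
  force-sound dominator (suc k) S (0<U , _) (suc m) (s≤s k≤m) | [] | ∈w | _ =
    ⊥-elim (¬∈[] (∈w (proj₂ (nonempty⇒hits {undominated S} 0<U))))
  force-sound staller (suc k) S (v , h , _) (suc m) (s≤s k≤m) | [] | ∈w | _ =
    ⊥-elim (¬∈[] (∈w h))
  force-sound dominator (suc k) S (_ , F) (suc m) (s≤s k≤m) | v ∷ vs | _ | h =
    s≤s (≤-min _ v vs λ {w} w∈ → force-sound staller k (w ∷ S) (F w (h w∈)) m k≤m)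
  force-sound staller (suc k) S (w , h , F) (suc m) (s≤s k≤m) | v ∷ vs | ∈w | _ =
    s≤s (≤-trans (force-sound dominator k (w ∷ S) F m k≤m) (≤-max _ v vs (∈w h)))

-- Invariance under isomorphism

≅-sym : ∀ {m n} {G : Graph m} {H : Graph n} → G ≅ H → H ≅ G
≅-sym {G = G} {H} i = record
  { bijection = ↔-sym bijection
  ; adjacency = λ u v → record
    { to        = λ e → Equivalence.from (adjacency (from u) (from v))
                          (subst₂ (Graph._~_ H) (sym (strictlyInverseˡ u)) (sym (strictlyInverseˡ v)) e)
    ; from      = λ e → subst₂ (Graph._~_ H) (strictlyInverseˡ u) (strictlyInverseˡ v)
                          (Equivalence.to (adjacency (from u) (from v)) e)
    ; to-cong   = λ { refl → refl }
    ; from-cong = λ { refl → refl }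
    }
  }
  where
  open _≅_ i
  open Inverse bijection

≅-trans : ∀ {l m n} {F : Graph l} {G : Graph m} {H : Graph n} → F ≅ G → G ≅ H → F ≅ H
≅-trans i j = record
  { bijection = ↔-trans I.bijection J.bijection
  ; adjacency = λ u v → record
    { to        = Equivalence.to (J.adjacency _ _) ∘ Equivalence.to (I.adjacency u v)
    ; from      = Equivalence.from (I.adjacency u v) ∘ Equivalence.from (J.adjacency _ _)
    ; to-cong   = λ { refl → refl }
    ; from-cong = λ { refl → refl }
    }
  }
  where
  module I = _≅_ i
  module J = _≅_ j

module _ {m n} {G : Graph m} {H : Graph n} (i : G ≅ H) where
  private
    module H = Graph H
  open _≅_ i
  open Inverse bijection using (to; from; strictlyInverseˡ)

  to-injective : ∀ {u v} → to u ≡ to v → u ≡ v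
  to-injective {u} {v} e = trans (sym (Inverse.strictlyInverseʳ bijection u))
    (trans (cong from e) (Inverse.strictlyInverseʳ bijection v))

  dominates⁺ : ∀ {u v} → Dominates G u v → Dominates H (to u) (to v)
  dominates⁺ (inj₁ e) = inj₁ (cong to e)
  dominates⁺ (inj₂ e) = inj₂ (Equivalence.to (adjacency _ _) e)

  dominates⁻ : ∀ {u v} → Dominates H (to u) (to v) → Dominates G u v
  dominates⁻ (inj₁ e) = inj₁ (to-injective e)
  dominates⁻ (inj₂ e) = inj₂ (Equivalence.from (adjacency _ _) e)

  legal⁺ : ∀ S {v} → Legal G S v → Legal H (map to S) (to v)
  legal⁺ S (x , d , ¬d) = to x , dominates⁺ d , ¬d ∘ Any.map dominates⁻ ∘ map⁻

  legal⁻ : ∀ S {v} → Legal H (map to S) v → Legal G S (from v)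
  legal⁻ S {v} (x , d , ¬d) = from x
    , dominates⁻ (subst₂ (Dominates H) (sym (strictlyInverseˡ v)) (sym (strictlyInverseˡ x)) d)
    , λ d′ → ¬d (subst (Dominated H (map to S)) (strictlyInverseˡ x)
                   (map⁺ (Any.map dominates⁺ d′)))

  -- For Dominator each move in H is answered by its preimage in G, for Staller
  -- each move in G by its image in H; both inductions give the same inequality,
  -- and equality follows from the inverse isomorphism.
  movesLeft-≤ : ∀ k p S → movesLeft G k p S ≤ movesLeft H k p (map to S)
  movesLeft-≤ zero p S = z≤n
  movesLeft-≤ (suc k) p S
    with legalMoves G S | Game.∈⇒legal G S | Game.legal⇒∈ G S
       | legalMoves H (map to S) | Game.∈⇒legal H (map to S) | Game.legal⇒∈ H (map to S)
  ... | []     | _ | _ | _ | _ | _ = z≤n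
  ... | v ∷ vs | l | _ | [] | _ | m = ⊥-elim (Game.¬∈[] H (m (legal⁺ S (l (here refl)))))
  movesLeft-≤ (suc k) dominator S | v ∷ vs | l | m | w ∷ ws | l′ | m′ =
    s≤s (≤-min _ w ws λ {x} x∈ → ≤-trans (min-≤ _ v vs (m (legal⁻ S (l′ x∈))))
      (subst (λ y → movesLeft G k staller (from x ∷ S) ≤ movesLeft H k staller (y ∷ map to S))
        (strictlyInverseˡ x) (movesLeft-≤ k staller (from x ∷ S))))
  movesLeft-≤ (suc k) staller S | v ∷ vs | l | m | w ∷ ws | l′ | m′ =
    s≤s (max-≤ _ v vs λ {x} x∈ → ≤-trans (movesLeft-≤ k dominator (x ∷ S))
      (≤-max _ w ws (m′ (legal⁺ S (l x∈)))))

γg-≤ : ∀ {m n} {G : Graph m} {H : Graph n} → G ≅ H → γg G ≤ γg H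
γg-≤ {m} {H = H} i with refl ← ↔⇒≡ (_≅_.bijection i) = movesLeft-≤ i m dominator []

γg-cong : ∀ {m n} {G : Graph m} {H : Graph n} → G ≅ H → γg G ≡ γg H
γg-cong i = ≤-antisym (γg-≤ i) (γg-≤ (≅-sym i))

-- Dominator's strategy on a graph of diameter two

count≥2 : ∀ {n} {f : Fin n → Bool} {i j} → T (f i) → T (f j) → i ≢ j → 2 ≤ count f
count≥2 {f = f} {i} {j} ti tj i≢j = subst (2 ≤_) (sym (count-remove f i ti))
  (s≤s (count>0 j (∧-intro {f j} tj (not-T (i≢j ∘ does-T (i ≟ j))))))

-- If 2 c ≥ 8 + 3 k, then 4 c + 2 g ≥ 20 + 6 k; but 4 c + 2 g is the sum of
-- 3 (c + g) ≤ 15 + 6 k and c - g ≤ 4.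
few-left : ∀ {c g k} → 2 ≤ g → c + g ≤ 5 + k * 2 → c ≤ 4 + g → c + c ≤ 7 + k * 3
few-left {c} {g} {k} 2≤g p q = ℕₚ.≮⇒≥ λ l → ℕₚ.1+n≰n {19 + k * 6} (begin
  20 + k * 6                                  ≡⟨ e₁ k ⟩
  (8 + k * 3) + (8 + k * 3) + (2 + 2)         ≤⟨ +-mono-≤ (+-mono-≤ l l) (+-mono-≤ 2≤g 2≤g) ⟩
  (c + c) + (c + c) + (g + g)                 ≡⟨ e₂ c g ⟩
  (c + c + c) + (g + g) + c                   ≤⟨ ℕₚ.+-monoʳ-≤ ((c + c + c) + (g + g)) q ⟩
  (c + c + c) + (g + g) + (4 + g)             ≡⟨ e₃ c g ⟩
  (c + g) + (c + g) + (c + g) + 4             ≤⟨ ℕₚ.+-monoˡ-≤ 4 (+-mono-≤ (+-mono-≤ p p) p) ⟩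
  (5 + k * 2) + (5 + k * 2) + (5 + k * 2) + 4 ≡⟨ e₄ k ⟩
  19 + k * 6                                  ∎)
  where
  open ≤-Reasoning
  e₁ : ∀ k → 20 + k * 6 ≡ (8 + k * 3) + (8 + k * 3) + (2 + 2)
  e₁ = solve-∀
  e₂ : ∀ c g → (c + c) + (c + c) + (g + g) ≡ (c + c + c) + (g + g) + c
  e₂ = solve-∀
  e₃ : ∀ c g → (c + c + c) + (g + g) + (4 + g) ≡ (c + g) + (c + g) + (c + g) + 4
  e₃ = solve-∀
  e₄ : ∀ k → (5 + k * 2) + (5 + k * 2) + (5 + k * 2) + 4 ≡ 19 + k * 6
  e₄ = solve-∀

module Strategy {n} (G : Graph n) where
  open Graph G
  open Game G

  full : State n
  full _ = true

  adj : Fin n → Fin n → Bool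
  adj u v = does (u ~? v)

  deg : Fin n → ℕ
  deg v = count (adj v)

  finish-empty : ∀ p k {U} → count U ≡ 0 → Finish p k U
  finish-empty p         zero    e = e
  finish-empty dominator (suc k) e = inj₁ e
  finish-empty staller   (suc k) e v h = ⊥-elim (0<⇒≢0 (hits⇒size h) e)

  hit-drop : ∀ {h v} U → h ≤ hits v U → h + count (U ⊖ v) ≤ count U
  hit-drop {v = v} U p = ≤-trans (ℕₚ.+-monoˡ-≤ _ p) (≤-reflexive (sym (size-⊖ U v)))

  -- One move of Dominator hitting h vertices, and any reply of Staller, leave
  -- at most |U| - h - 1 vertices.
  round : ∀ {v h k U} → 0 < h → h ≤ hits v U →
          (∀ U′ → h + suc (count U′) ≤ count U → Finish dominator k U′) →
          Finish dominator (suc (suc k)) U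
  round {v} {h} {k} {U} 0<h p F = inj₂ (v , ≤-trans 0<h p , λ w q → F (U ⊖ v ⊖ w)
    (≤-trans (ℕₚ.+-monoʳ-≤ h (hit-drop (U ⊖ v) q)) (hit-drop U p)))

  -- Either some move hits more than h vertices or all hit at most h.
  large? : ∀ h U → (∃[ v ] (h < hits v U)) ⊎ (∀ v → hits v U ≤ h)
  large? h U with any? (λ v → h <? hits v U)
  ... | yes (v , p) = inj₁ (v , p)
  ... | no ¬p       = inj₂ λ v → ℕₚ.≮⇒≥ λ q → ¬p (v , q)

  hits-full : ∀ v → hits v full ≡ suc (deg v)
  hits-full v = trans (count-remove (cl v) v (cl-refl v))
    (cong suc (count-cong λ y → T-ext (⇒ y) (⇐ y)))
    where
    ⇒ : ∀ y → T (cl v y ∧ not (does (v ≟ y))) → T (adj v y)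
    ⇒ y t with does-T (dominates? G v y) (∧-fst t)
    ... | inj₁ e = ⊥-elim (T-not (∧-snd {cl v y} t) (T-does (v ≟ y) e))
    ... | inj₂ a = T-does (v ~? y) a
    ⇐ : ∀ y → T (adj v y) → T (cl v y ∧ not (does (v ≟ y)))
    ⇐ y t = ∧-intro {cl v y} (T-does (dominates? G v y) (inj₂ (does-T (v ~? y) t)))
      (not-T λ e → ~-irrefl (subst (v ~_) (sym (does-T (v ≟ y) e)) (does-T (v ~? y) t)))

  size-full : ∀ v → n ≡ suc (deg v + count (full ⊖ v))
  size-full v = trans (sym (count-all n)) (trans (size-⊖ full v) (cong (_+ count (full ⊖ v)) (hits-full v)))

  module Near (near : ∀ u v → u ≡ v ⊎ u ~ v ⊎ ∃[ w ] (u ~ w × w ~ v)) where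

    common : ∀ u v → ∃[ w ] (Dominates G w u × Dominates G w v)
    common u v with near u v
    ... | inj₁ e                    = u , inj₁ refl , inj₁ e
    ... | inj₂ (inj₁ a)             = u , inj₁ refl , inj₂ a
    ... | inj₂ (inj₂ (w , a , b))   = w , inj₂ (~-sym a) , inj₂ b

    -- Two undominated vertices are dominated by a common vertex, so Dominator
    -- can always hit two of them.
    greedy : ∀ {U} → 0 < count U →
             ∃[ v ] (0 < hits v U × (count (U ⊖ v) ≡ 0 ⊎ 2 ≤ hits v U))
    greedy {U} p with x , tx ← count>0⇒∃ p | 1 <? count U
    ... | no q = x , self-hits {U} tx
               , inj₁ (ℕₚ.n≤0⇒n≡0 (ℕₚ.≤-pred (≤-trans (hit-drop U (self-hits {U} tx)) (ℕₚ.≮⇒≥ q))))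
    ... | yes q with y , ty ← count>0⇒∃ (ℕₚ.≤-pred (subst (1 <_) (count-remove U x tx) q))
                with w , dx , dy ← common x y = w , ≤-trans (s≤s z≤n) two , inj₂ two
      where
      two : 2 ≤ hits w U
      two = count≥2 (∧-intro {U x} tx (T-does (dominates? G w x) dx))
                    (∧-intro {U y} (∧-fst ty) (T-does (dominates? G w y) dy))
                    (λ e → T-not (∧-snd {U y} ty) (T-does (x ≟ y) e))

    -- Hitting two vertices in every move of Dominator and one in every reply of
    -- Staller, three undominated vertices cost two moves.
    rate : ∀ k U → count U + count U ≤ 1 + k * 3 → Finish dominator k U
    rate zero U p with count U
    ... | zero = refl
    ... | suc c with s≤s q ← p with () ← ℕₚ.m+n≤o⇒n≤o c q
    rate (suc k) U p with 0 <? count U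
    ... | no q = inj₁ (ℕₚ.n≤0⇒n≡0 (ℕₚ.≮⇒≥ q))
    rate (suc zero) U p | yes q with v , h , d ← greedy {U} q = inj₂ (v , h , end d)
      where
      half : ∀ {c} → c + c ≤ 4 → c ≤ 2
      half {c} r = ℕₚ.≮⇒≥ λ l → ℕₚ.<⇒≱ (s≤s (s≤s (s≤s (s≤s (s≤s (z≤n {1})))))) (≤-trans (+-mono-≤ l l) r)
      end : count (U ⊖ v) ≡ 0 ⊎ 2 ≤ hits v U → count (U ⊖ v) ≡ 0
      end (inj₁ e) = e
      end (inj₂ t) = ℕₚ.n≤0⇒n≡0 (ℕₚ.+-cancelˡ-≤ 2 _ _ (≤-trans (hit-drop U t) (half p)))
    rate (suc (suc k)) U p | yes q with greedy {U} q
    ... | v , h , inj₁ e = inj₂ (v , h , finish-empty staller (suc k) e)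
    ... | v , h , inj₂ t = round (s≤s z≤n) t λ U′ r → rate k U′ (ℕₚ.+-cancelˡ-≤ 6 _ _ (begin
      6 + (count U′ + count U′)          ≡⟨ double (count U′) ⟩
      (3 + count U′) + (3 + count U′)    ≤⟨ +-mono-≤ r r ⟩
      count U + count U                  ≤⟨ p ⟩
      6 + (1 + k * 3)                    ∎))
      where
      open ≤-Reasoning
      double : ∀ c → 6 + (c + c) ≡ (3 + c) + (3 + c)
      double = solve-∀

    -- If every closed neighbourhood meets U in at most h + 1 vertices, then every
    -- neighbour of x ∈ U brings at most h vertices of U other than x within
    -- distance 2 of x; but all of U is within that distance.
    spread : ∀ {U h} → (∀ v → hits v U ≤ suc h) → ∀ x → T (U x) → count U ≤ suc (deg x * h)
    spread {U} {h} bound x tx = subst (_≤ suc (deg x * h)) (sym (count-remove U x tx))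
      (s≤s (≤-trans (≤-reflexive (sym (ℕₚ.*-identityʳ _))) (double-count cl lower upper)))
      where
      others : Fin n → Bool
      others y = U y ∧ not (does (x ≟ y))
      lower : ∀ y → T (others y) → 1 ≤ count (λ z → adj x z ∧ cl z y)
      lower y t with near x y
      ... | inj₁ e = ⊥-elim (T-not (∧-snd {U y} t) (T-does (x ≟ y) e))
      ... | inj₂ (inj₁ a) = count>0 y (∧-intro (T-does (x ~? y) a) (cl-refl y))
      ... | inj₂ (inj₂ (w , a , b)) = count>0 w (∧-intro (T-does (x ~? w) a) (T-does (dominates? G w y) (inj₂ b)))
      upper : ∀ z → T (adj x z) → count (λ y → others y ∧ cl z y) ≤ h
      upper z t = ℕₚ.≤-pred (begin
        suc (count (λ y → others y ∧ cl z y))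
          ≤⟨ s≤s (count-mono λ y u → ∧-intro {U y ∧ cl z y}
               (∧-intro {U y} (∧-fst {U y} (∧-fst {others y} u)) (∧-snd {others y} u))
               (∧-snd {U y} (∧-fst {others y} u))) ⟩
        suc (count (λ y → (U y ∧ cl z y) ∧ not (does (x ≟ y))))
          ≡⟨ count-remove (λ y → U y ∧ cl z y) x
               (∧-intro {U x} tx (T-does (dominates? G z x) (inj₂ (~-sym (does-T (x ~? z) t))))) ⟨
        hits z U
          ≤⟨ bound z ⟩
        suc h ∎)
        where open ≤-Reasoning

    module Bounded (Δ : ℕ) (deg≤ : ∀ v → deg v ≤ Δ) where

      -- The Moore bound: spread with U the whole vertex set.
      moore : ∀ v → n ≤ suc (deg v * Δ)
      moore v = subst (_≤ suc (deg v * Δ)) (count-all n)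
        (spread {full} (λ w → ≤-trans (≤-reflexive (hits-full w)) (s≤s (deg≤ w))) v tt)

      -- When no move hits three vertices, at most Δ + 1 of them are left.
      sparse : ∀ {U} → (∀ v → hits v U ≤ 2) → count U ≤ suc Δ
      sparse {U} bound with 0 <? count U
      ... | no q = ≤-trans (ℕₚ.≮⇒≥ q) z≤n
      ... | yes q with x , tx ← count>0⇒∃ q =
        ≤-trans (spread {U} bound x tx) (s≤s (≤-trans (≤-reflexive (ℕₚ.*-identityʳ _)) (deg≤ x)))

      -- While some move hits three vertices, a round costs two moves and removes at
      -- least four vertices.  Afterwards at most Δ + 1 vertices are left, and the
      -- credit g pays for finishing at the slower rate.
      descend : ∀ {g} → 2 ≤ g → Δ ≤ 3 + g → ∀ k U → count U + g ≤ 1 + k * 2 → Finish dominator k U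
      descend {g} 2≤g Δ≤ zero U p = ⊥-elim (ℕₚ.<⇒≱ 2≤g (≤-trans (m≤n+m g (count U)) p))
      descend {g} 2≤g Δ≤ (suc zero) U p = rate 1 U (≤-trans (+-mono-≤ one one) (s≤s (s≤s z≤n)))
        where
        one : count U ≤ 1
        one = ℕₚ.+-cancelʳ-≤ 2 _ _ (≤-trans (ℕₚ.+-monoʳ-≤ (count U) 2≤g) p)
      descend {g} 2≤g Δ≤ (suc (suc k)) U p with large? 2 U
      ... | inj₁ (v , h) = round (s≤s z≤n) h λ U′ r → descend 2≤g Δ≤ k U′
        (ℕₚ.+-cancelˡ-≤ 4 _ _ (≤-trans (ℕₚ.+-monoˡ-≤ g r) p))
      ... | inj₂ small = rate (suc (suc k)) U (few-left {k = k} 2≤g p (≤-trans (sparse {U} small) (s≤s Δ≤)))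

      -- The credit can be dropped when Δ ≤ 4 and the number of moves is odd: then
      -- the slow phase starts with at most five vertices and at least three moves.
      descend-odd : Δ ≤ 4 → ∀ j U → count U ≤ 2 + j * 4 → Finish dominator (suc (j * 2)) U
      descend-odd Δ≤4 zero U p = rate 1 U (+-mono-≤ p p)
      descend-odd Δ≤4 (suc j) U p with large? 2 U
      ... | inj₁ (v , h) = round (s≤s z≤n) h λ U′ r → descend-odd Δ≤4 j U′
        (ℕₚ.+-cancelˡ-≤ 4 _ _ (≤-trans r p))
      ... | inj₂ small = rate (suc (suc (suc (j * 2)))) U
        (≤-trans (+-mono-≤ five five) (m≤m+n 10 _))
        where
        five : count U ≤ 5
        five = ≤-trans (sparse {U} small) (s≤s Δ≤4)

-- Relabelling vertices by colour

-- The number of elements of colour a.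
class : ∀ {n k} → (Fin n → Fin k) → Fin k → ℕ
class c a = count λ i → does (a ≟ c i)

opaque
  unfolding count

  count-punchIn : ∀ {n} (f : Fin (suc n) → Bool) j → count f ≡ # f j + count (f ∘ punchIn j)
  count-punchIn f j = trans (count≡sum f)
    (trans (sum-remove {i = j} (λ i → # f i)) (cong (# f j +_) (sym (count≡sum (f ∘ punchIn j)))))

  count-permute : ∀ {m n} (f : Fin n → Bool) (π : Permutation m n) →
                  count f ≡ count (f ∘ (π ⟨$⟩ʳ_))
  count-permute f π = trans (count≡sum f)
    (trans (sum-permute (λ i → # f i) π) (sym (count≡sum (f ∘ (π ⟨$⟩ʳ_)))))

opaque
  -- Two colourings with equal class sizes differ by a permutation.
  rearrange : ∀ {n k} (c d : Fin n → Fin k) → (∀ a → class c a ≡ class d a) →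
              ∃[ π ] (∀ i → c (π ⟨$⟩ʳ i) ≡ d i)
  rearrange {zero}  c d eq = idₚ , λ ()
  rearrange {suc n} c d eq
    with j , t ← count>0⇒∃ (subst (0 <_) (sym (eq (d zero))) (count>0 {f = λ i → does (d zero ≟ d i)} zero (T-does (d zero ≟ d zero) refl)))
    with e ← does-T (d zero ≟ c j) t
    with ρ , q ← rearrange (c ∘ punchIn j) (d ∘ suc) (λ a → ℕₚ.+-cancelˡ-≡ (# does (a ≟ d zero)) _ _
      (trans (cong (λ b → # does (a ≟ b) + class (c ∘ punchIn j) a) e)
        (trans (sym (count-punchIn (λ i → does (a ≟ c i)) j))
          (trans (eq a) (count-punchIn (λ i → does (a ≟ d i)) zero)))))
    = insert zero j ρ , λ
      { zero    → sym e
      ; (suc i) → trans (cong c (insert-punchIn zero j ρ i)) (q i)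
      }

-- The graph G with vertex u renamed from π u.
relabel : ∀ {m n} → Permutation m n → Graph n → Graph m
relabel π G = record
  { _~_      = λ u v → (π ⟨$⟩ʳ u) ~ (π ⟨$⟩ʳ v)
  ; ~-sym    = ~-sym
  ; ~-irrefl = ~-irrefl
  ; _~?_     = λ u v → (π ⟨$⟩ʳ u) ~? (π ⟨$⟩ʳ v)
  }
  where open Graph G

relabel-≅ : ∀ {m n} (π : Permutation m n) (G : Graph n) → relabel π G ≅ G
relabel-≅ π G = record
  { bijection = π
  ; adjacency = λ u v → record { to = λ e → e ; from = λ e → e ; to-cong = λ { refl → refl } ; from-cong = λ { refl → refl } }
  }

-- Boolean evaluation of the game on adjacency matrices

Matrix : Set → ℕ → Set
Matrix A n = Vec (Vec A n) n

allB : ∀ {n} → (Fin n → Bool) → Bool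
allB {zero}  f = true
allB {suc n} f = f zero ∧ allB (f ∘ suc)

allB-sound : ∀ {n} (f : Fin n → Bool) → T (allB f) → ∀ i → T (f i)
allB-sound {suc n} f t zero    = ∧-fst t
allB-sound {suc n} f t (suc i) = allB-sound (f ∘ suc) (∧-snd {f zero} t) i

isEmpty : ∀ {n} → Vec Bool n → Bool
isEmpty []          = true
isEmpty (true  ∷ V) = false
isEmpty (false ∷ V) = isEmpty V

-- Whether two sets, given by their characteristic vectors, intersect.
meets : ∀ {n} → Vec Bool n → Vec Bool n → Bool
meets []          []      = false
meets (true  ∷ V) (b ∷ r) = b ∨ meets V r
meets (false ∷ V) (b ∷ r) = meets V r

minus : ∀ {n} → Vec Bool n → Vec Bool n → Vec Bool n
minus = zipWith λ a b → a ∧ not b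

anyRow allRow : ∀ {A : Set} {m} → (A → Bool) → Vec A m → Bool
anyRow f []      = false
anyRow f (r ∷ M) = f r ∨ anyRow f M
allRow f []      = true
allRow f (r ∷ M) = f r ∧ allRow f M

module _ {n} (M : Matrix Bool n) where

  -- Finish and Force evaluated on the matrix M of closed neighbourhoods.
  finish? : Player → ℕ → Vec Bool n → Bool
  finish? p         zero    V = isEmpty V
  finish? dominator (suc k) V =
    isEmpty V ∨ anyRow (λ r → meets V r ∧ finish? staller k (minus V r)) M
  finish? staller   (suc k) V =
    allRow (λ r → not (meets V r) ∨ finish? dominator k (minus V r)) M

  force? : Player → ℕ → Vec Bool n → Bool
  force? p         zero    V = true
  force? dominator (suc k) V =
    not (isEmpty V) ∧ allRow (λ r → not (meets V r) ∨ force? staller k (minus V r)) M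
  force? staller   (suc k) V = anyRow (λ r → meets V r ∧ force? dominator k (minus V r)) M

∨-elim : ∀ {a b} {C : Set} → T (a ∨ b) → (T a → C) → (T b → C) → C
∨-elim {true}  _ f _ = f tt
∨-elim {false} t _ g = g t

anyRow-sound : ∀ {A : Set} {m} (f : A → Bool) (M : Vec A m) → T (anyRow f M) → ∃[ i ] T (f (lookup M i))
anyRow-sound f (r ∷ M) t = ∨-elim {f r} t (zero ,_) λ u →
  let i , s = anyRow-sound f M u in suc i , s

allRow-sound : ∀ {A : Set} {m} (f : A → Bool) (M : Vec A m) → T (allRow f M) → ∀ i → T (f (lookup M i))
allRow-sound f (r ∷ M) t zero    = ∧-fst t
allRow-sound f (r ∷ M) t (suc i) = allRow-sound f M (∧-snd {f r} t) i

-- The vector V tabulates the predicate U.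
_represents_ : ∀ {n} → Vec Bool n → (Fin n → Bool) → Set
V represents U = ∀ x → lookup V x ≡ U x

minus-represents : ∀ {n} {V r : Vec Bool n} {U f} → V represents U → r represents f →
                   minus V r represents (λ x → U x ∧ not (f x))
minus-represents {V = V} {r} p q x =
  trans (lookup-zipWith (λ a b → a ∧ not b) x V r) (cong₂ (λ a b → a ∧ not b) (p x) (q x))

opaque
  unfolding count

  isEmpty⇒ : ∀ {n} (V : Vec Bool n) {U} → V represents U → T (isEmpty V) → count U ≡ 0
  isEmpty⇒ []          p t = refl
  isEmpty⇒ (false ∷ V) p t = cong₂ _+_ (cong #_ (sym (p zero))) (isEmpty⇒ V (p ∘ suc) t)

  isEmpty⇐ : ∀ {n} (V : Vec Bool n) {U} → V represents U → T (not (isEmpty V)) → 0 < count U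
  isEmpty⇐ (true  ∷ V) {U} p t rewrite sym (p zero) = s≤s z≤n
  isEmpty⇐ (false ∷ V) p t rewrite sym (p zero) = isEmpty⇐ V (p ∘ suc) t

  meets⇒ : ∀ {n} (V r : Vec Bool n) {U f} → V represents U → r represents f →
           T (meets V r) → 0 < count (λ x → U x ∧ f x)
  meets⇒ [] [] p q ()
  meets⇒ (true ∷ V) (true ∷ r) p q t rewrite sym (p zero) | sym (q zero) = s≤s z≤n
  meets⇒ (true ∷ V) (false ∷ r) p q t rewrite sym (p zero) | sym (q zero) = meets⇒ V r (p ∘ suc) (q ∘ suc) t
  meets⇒ (false ∷ V) (b ∷ r) p q t rewrite sym (p zero) = meets⇒ V r (p ∘ suc) (q ∘ suc) t

  meets⇐ : ∀ {n} (V r : Vec Bool n) {U f} → V represents U → r represents f →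
           0 < count (λ x → U x ∧ f x) → T (meets V r)
  meets⇐ []          []          p q ()
  meets⇐ (true ∷ V)  (true ∷ r)  p q h = tt
  meets⇐ (true ∷ V)  (false ∷ r) p q h rewrite sym (p zero) | sym (q zero) = meets⇐ V r (p ∘ suc) (q ∘ suc) h
  meets⇐ (false ∷ V) (b ∷ r)     p q h rewrite sym (p zero) = meets⇐ V r (p ∘ suc) (q ∘ suc) h

module Reflect {n} (G : Graph n) (M : Matrix Bool n)
               (M-rep : ∀ u → lookup M u represents Game.cl G u) where
  open Game G

  finish?-sound : ∀ p k V {U} → V represents U → T (finish? M p k V) → Finish p k U
  finish?-sound p zero V rep t = isEmpty⇒ V rep t
  finish?-sound dominator (suc k) V rep t = ∨-elim {isEmpty V} t (inj₁ ∘ isEmpty⇒ V rep) λ s →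
    let v , u = anyRow-sound _ M s in
    inj₂ (v , meets⇒ V (lookup M v) rep (M-rep v) (∧-fst u)
            , finish?-sound staller k (minus V (lookup M v)) (minus-represents {V = V} rep (M-rep v))
                (∧-snd {meets V (lookup M v)} u))
  finish?-sound staller (suc k) V rep t v h =
    ∨-elim {not (meets V (lookup M v))} (allRow-sound _ M t v)
      (λ s → ⊥-elim (T-not s (meets⇐ V (lookup M v) rep (M-rep v) h)))
      (finish?-sound dominator k (minus V (lookup M v)) (minus-represents {V = V} rep (M-rep v)))

  force?-sound : ∀ p k V {U} → V represents U → T (force? M p k V) → Force p k U
  force?-sound p zero V rep t = tt
  force?-sound dominator (suc k) V rep t = isEmpty⇐ V rep (∧-fst t) , λ v h →
    ∨-elim {not (meets V (lookup M v))} (allRow-sound _ M (∧-snd {not (isEmpty V)} t) v)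
      (λ s → ⊥-elim (T-not s (meets⇐ V (lookup M v) rep (M-rep v) h)))
      (force?-sound staller k (minus V (lookup M v)) (minus-represents {V = V} rep (M-rep v)))
  force?-sound staller (suc k) V rep t =
    let v , u = anyRow-sound _ M t in
    v , meets⇒ V (lookup M v) rep (M-rep v) (∧-fst u)
      , force?-sound dominator k (minus V (lookup M v)) (minus-represents {V = V} rep (M-rep v))
          (∧-snd {meets V (lookup M v)} u)

opaque
  -- The rows of this matrix are the closed neighbourhoods.
  closedMatrix : ∀ {n} → Graph n → Matrix Bool n
  closedMatrix G = tabulate λ u → tabulate λ v → does (dominates? G u v)

  closedMatrix-rep : ∀ {n} (G : Graph n) u → lookup (closedMatrix G) u represents Game.cl G u
  closedMatrix-rep G u v = trans (cong (λ r → lookup r v) (lookup∘tabulate _ u)) (lookup∘tabulate _ v)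

-- Testing two matrices for isomorphism

-- The map with the given finite graph, and the identity elsewhere.
assoc : ∀ {n} → List (Fin n × Fin n) → Fin n → Fin n
assoc []            u = u
assoc ((v , x) ∷ l) u = if does (u ≟ v) then x else assoc l u

infix 4 _==_
_==_ : Bool → Bool → Bool
true  == b = b
false == b = not b

==-sound : ∀ a b → T (a == b) → a ≡ b
==-sound true  true  _ = refl
==-sound false false _ = refl

module _ {n} (M N : Matrix Bool n) where

  entry : Matrix Bool n → Fin n → Fin n → Bool
  entry A u v = lookup (lookup A u) v

  -- Whether sending u to x extends the partial isomorphism l.
  consistent : Fin n → Fin n → List (Fin n × Fin n) → Bool
  consistent u x []            = true
  consistent u x ((v , y) ∷ l) =
    not (does (x ≟ y)) ∧ ((entry M u v == entry N x y) ∧ consistent u x l)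

  -- Backtracking extension of a partial isomorphism to the listed vertices.
  -- The result is checked by verify, so nothing has to be proved about it.
  matchFrom : List (Fin n) → List (Fin n × Fin n) → Maybe (List (Fin n × Fin n))
  matchAny  : Fin n → List (Fin n) → List (Fin n) → List (Fin n × Fin n) → Maybe (List (Fin n × Fin n))
  matchFrom []       l = just l
  matchFrom (u ∷ us) l = matchAny u (allFin n) us l
  matchAny u []       us l = nothing
  matchAny u (x ∷ xs) us l =
    if consistent u x l then (matchFrom us ((u , x) ∷ l) <∣> matchAny u xs us l)
                        else matchAny u xs us l

  -- Whether f and g are mutually inverse and f carries M to N.
  verify : (Fin n → Fin n) → (Fin n → Fin n) → Bool
  verify f g = allB (λ u → does (g (f u) ≟ u)) ∧ (allB (λ x → does (f (g x) ≟ x))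
             ∧ allB (λ u → allB λ v → entry M u v == entry N (f u) (f v)))

  verifyMatch : Maybe (List (Fin n × Fin n)) → Bool
  verifyMatch nothing  = false
  verifyMatch (just l) = verify (assoc l) (assoc (map swap l))

  isomorphic? : Bool
  isomorphic? = verifyMatch (matchFrom (allFin n) [])

module _ {n} (G H : Graph n) (M N : Matrix Bool n)
         (M-rep : ∀ u → lookup M u represents Game.cl G u)
         (N-rep : ∀ u → lookup N u represents Game.cl H u) where

  verify-sound : ∀ f g → T (verify M N f g) → G ≅ H
  verify-sound f g t = record
    { bijection = mk↔ₛ′ f g (λ x → does-T (f (g x) ≟ x) (allB-sound _ (∧-fst t₂) x)) inv
    ; adjacency = λ u v → record
      { to = ⇒ u v ; from = ⇐ u v ; to-cong = λ { refl → refl } ; from-cong = λ { refl → refl } }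
    }
    where
    t₂ = ∧-snd {allB λ u → does (g (f u) ≟ u)} t
    t₃ = ∧-snd {allB λ x → does (f (g x) ≟ x)} t₂
    inv : ∀ u → g (f u) ≡ u
    inv u = does-T (g (f u) ≟ u) (allB-sound _ (∧-fst t) u)
    same : ∀ u v → Game.cl G u v ≡ Game.cl H (f u) (f v)
    same u v = trans (sym (M-rep u v)) (trans
      (==-sound _ _ (allB-sound _ (allB-sound _ t₃ u) v)) (N-rep (f u) (f v)))
    ⇒ : ∀ u v → Graph._~_ G u v → Graph._~_ H (f u) (f v)
    ⇒ u v a with does-T (dominates? H (f u) (f v)) (subst T (same u v) (T-does (dominates? G u v) (inj₂ a)))
    ... | inj₂ b = b
    ... | inj₁ e = ⊥-elim (Graph.~-irrefl G (subst (Graph._~_ G u)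
                     (trans (sym (inv v)) (trans (cong g (sym e)) (inv u))) a))
    ⇐ : ∀ u v → Graph._~_ H (f u) (f v) → Graph._~_ G u v
    ⇐ u v a with does-T (dominates? G u v) (subst T (sym (same u v)) (T-does (dominates? H (f u) (f v)) (inj₂ a)))
    ... | inj₂ b    = b
    ... | inj₁ refl = ⊥-elim (Graph.~-irrefl H a)

  isomorphic?-sound : T (isomorphic? M N) → G ≅ H
  isomorphic?-sound t with just l ← matchFrom M N (allFin n) [] = verify-sound _ _ t

-- Exhaustive search over partially known graphs

-- A partially known matrix of closed neighbourhoods.
Partial : ℕ → Set
Partial = Matrix (Maybe Bool)

-- The number of members of m that are known to lie in r.
marked : ∀ {n} → Vec Bool n → Vec (Maybe Bool) n → ℕ
marked []      []              = 0
marked (b ∷ m) (just true ∷ r) = # b + marked m r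
marked (b ∷ m) (_ ∷ r)         = marked m r

-- Whether some vertex is excluded from neither of two neighbourhoods.
mayMeet : ∀ {n} → Vec (Maybe Bool) n → Vec (Maybe Bool) n → Bool
mayMeet []               []               = false
mayMeet (just false ∷ r) (_ ∷ s)          = mayMeet r s
mayMeet (_ ∷ r)          (just false ∷ s) = mayMeet r s
mayMeet (_ ∷ r)          (_ ∷ s)          = true

-- Whether every vertex excluded from the neighbourhood r may still be at
-- distance 2 from its centre; e is r itself and p are the rows of the matrix.
mayReach : ∀ {m n} → Vec (Maybe Bool) n → Vec (Maybe Bool) m → Vec (Vec (Maybe Bool) n) m → Bool
mayReach r []               []      = true
mayReach r (just false ∷ e) (s ∷ p) = mayMeet r s ∧ mayReach r e p
mayReach r (_ ∷ e)          (_ ∷ p) = mayReach r e p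

-- Both entries uv and vu are set to b.
update : ∀ {n} → Fin n → Fin n → Bool → Partial n → Partial n
update u v b p = p [ u ]%= (_[ v ]≔ just b) [ v ]%= (_[ u ]≔ just b)

decodeRow : ∀ {n} → Vec (Maybe Bool) n → Maybe (Vec Bool n)
decodeRow []            = just []
decodeRow (nothing ∷ r) = nothing
decodeRow (just b  ∷ r) = Maybe.map (b ∷_) (decodeRow r)

decode : ∀ {m n} → Vec (Vec (Maybe Bool) n) m → Maybe (Vec (Vec Bool n) m)
decode []      = just []
decode (r ∷ p) = Maybe.zipWith _∷_ (decodeRow r) (decode p)

module _ {n} (caps : List (Vec Bool n × ℕ)) (test : Matrix Bool n → Bool) where

  -- A cap (m , h) demands that every closed neighbourhood contain at most h
  -- members of the set m.
  withinCaps : List (Vec Bool n × ℕ) → Vec (Maybe Bool) n → Bool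
  withinCaps []            r = true
  withinCaps ((m , h) ∷ l) r = (marked m r ≤ᵇ h) ∧ withinCaps l r

  -- After a pair is added the caps may fail, after a pair is removed the
  -- distance condition may fail.
  viableRow : Bool → Vec (Maybe Bool) n → Partial n → Bool
  viableRow true  r p = withinCaps caps r
  viableRow false r p = mayReach r r p

  viable : Bool → Fin n → Fin n → Partial n → Bool
  viable b u v p = viableRow b (lookup p u) p ∧ viableRow b (lookup p v) p

  leaf : Maybe (Matrix Bool n) → Bool
  leaf nothing  = false
  leaf (just M) = test M

  -- Decide the listed pairs one after another, abandoning an assignment as soon
  -- as a row of the pair last decided is not viable.  The result is true when
  -- every completely decided matrix that is reached passes the test.
  search : List (Fin n × Fin n) → Partial n → Bool
  branch : Maybe Bool → Fin n → Fin n → List (Fin n × Fin n) → Partial n → Bool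
  explore : Bool → Fin n → Fin n → List (Fin n × Fin n) → Partial n → Bool
  search []            p = leaf (decode p)
  search ((u , v) ∷ l) p = branch (lookup (lookup p u) v) u v l p
  branch (just _) u v l p = search l p
  branch nothing  u v l p = explore true u v l (update u v true p) ∧ explore false u v l (update u v false p)
  explore b u v l p = not (viable b u v p) ∨ search l p

-- The statement that the entry at a pair of vertices has a given value.
Fact : ℕ → Set
Fact n = Fin n × Fin n × Bool

-- Only the given facts and the diagonal are known; the diagonal is true
-- because neighbourhoods are closed.
initial : ∀ {n} → List (Fact n) → Partial n
initial []                = tabulate λ u → tabulate λ v → if does (u ≟ v) then just true else nothing
initial ((u , v , b) ∷ l) = update u v b (initial l)

-- Every known entry of r agrees with f.
RowKnown : ∀ {n} → Vec (Maybe Bool) n → (Fin n → Bool) → Set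
RowKnown r f = ∀ v {b} → lookup r v ≡ just b → f v ≡ b

opaque
  unfolding count

  marked-≤ : ∀ {n} (m : Vec Bool n) r {f} → RowKnown r f → marked m r ≤ count (λ y → lookup m y ∧ f y)
  marked-≤ []          []               k = z≤n
  marked-≤ (true  ∷ m) (just true ∷ r)  k rewrite k zero refl = s≤s (marked-≤ m r (k ∘ suc))
  marked-≤ (false ∷ m) (just true ∷ r)  k = marked-≤ m r (k ∘ suc)
  marked-≤ (b ∷ m)     (just false ∷ r) k = ≤-trans (marked-≤ m r (k ∘ suc)) (m≤n+m _ _)
  marked-≤ (b ∷ m)     (nothing ∷ r)    k = ≤-trans (marked-≤ m r (k ∘ suc)) (m≤n+m _ _)

mayMeet-complete : ∀ {n} (r s : Vec (Maybe Bool) n) {f g} → RowKnown r f → RowKnown s g →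
                   ∀ w → T (f w) → T (g w) → T (mayMeet r s)
mayMeet-complete (just false ∷ r) (_ ∷ s) k l zero t u = ⊥-elim (subst T (k zero refl) t)
mayMeet-complete (just false ∷ r) (_ ∷ s) k l (suc w) t u = mayMeet-complete r s (k ∘ suc) (l ∘ suc) w t u
mayMeet-complete (just true ∷ r) (just false ∷ s) k l zero t u = ⊥-elim (subst T (l zero refl) u)
mayMeet-complete (nothing ∷ r) (just false ∷ s) k l zero t u = ⊥-elim (subst T (l zero refl) u)
mayMeet-complete (just true ∷ r) (just false ∷ s) k l (suc w) t u = mayMeet-complete r s (k ∘ suc) (l ∘ suc) w t u
mayMeet-complete (nothing ∷ r) (just false ∷ s) k l (suc w) t u = mayMeet-complete r s (k ∘ suc) (l ∘ suc) w t u
mayMeet-complete (just true ∷ r) (just true ∷ s) k l w t u = tt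
mayMeet-complete (just true ∷ r) (nothing ∷ s) k l w t u = tt
mayMeet-complete (nothing ∷ r) (just true ∷ s) k l w t u = tt
mayMeet-complete (nothing ∷ r) (nothing ∷ s) k l w t u = tt

mayReach-complete : ∀ {m n} (r : Vec (Maybe Bool) n) (e : Vec (Maybe Bool) m) p {f} {g : Fin m → Fin n → Bool} →
  RowKnown r f → (∀ y → RowKnown (lookup p y) (g y)) →
  (∀ y → ∃[ w ] (T (f w) × T (g y w))) → T (mayReach r e p)
mayReach-complete r [] [] k l c = tt
mayReach-complete r (just false ∷ e) (s ∷ p) k l c with w , t , u ← c zero =
  ∧-intro (mayMeet-complete r s k (l zero) w t u) (mayReach-complete r e p k (l ∘ suc) (c ∘ suc))
mayReach-complete r (just true ∷ e) (s ∷ p) k l c = mayReach-complete r e p k (l ∘ suc) (c ∘ suc)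
mayReach-complete r (nothing ∷ e) (s ∷ p) k l c = mayReach-complete r e p k (l ∘ suc) (c ∘ suc)

decodeRow-sound : ∀ {n} (r : Vec (Maybe Bool) n) {s f} → decodeRow r ≡ just s → RowKnown r f → s represents f
decodeRow-sound (just b ∷ r) e k v with decodeRow r in eq
decodeRow-sound (just b ∷ r) refl k zero    | just s = sym (k zero refl)
decodeRow-sound (just b ∷ r) refl k (suc v) | just s = decodeRow-sound r eq (k ∘ suc) v

decode-sound : ∀ {m n} (p : Vec (Vec (Maybe Bool) n) m) {M} {g : Fin m → Fin n → Bool} → decode p ≡ just M →
               (∀ u → RowKnown (lookup p u) (g u)) → ∀ u → lookup M u represents g u
decode-sound (r ∷ p) e k u with decodeRow r in eq | decode p in eq′
decode-sound (r ∷ p) refl k zero    | just s | just M = decodeRow-sound r eq (k zero)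
decode-sound (r ∷ p) refl k (suc u) | just s | just M = decode-sound p eq′ (k ∘ suc) u

module SearchSound {n} (cl : Fin n → Fin n → Bool)
  (cl-refl : ∀ u → cl u u ≡ true) (cl-sym : ∀ u v → cl u v ≡ cl v u)
  (near : ∀ u v → ∃[ w ] (T (cl u w) × T (cl v w))) where

  Known : Partial n → Set
  Known p = ∀ u → RowKnown (lookup p u) (cl u)

  set-known : ∀ {u v b p} → cl u v ≡ b → Known p → Known (p [ u ]%= (_[ v ]≔ just b))
  set-known {u} {v} {b} {p} e k x y q with x ≟ u
  ... | no x≢u = k x y (trans (sym (cong (λ r → lookup r y) (lookup∘updateAt′ x u x≢u p))) q)
  ... | yes refl with y ≟ v
  ...   | yes refl = trans e (just-injective (trans (sym (lookup∘update v (lookup p u) (just b)))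
                       (trans (cong (λ r → lookup r v) (sym (lookup∘updateAt u p))) q)))
  ...   | no y≢v = k u y (trans (sym (lookup∘update′ y≢v (lookup p u) (just b)))
                       (trans (cong (λ r → lookup r y) (sym (lookup∘updateAt u p))) q))

  update-known : ∀ {u v b p} → cl u v ≡ b → Known p → Known (update u v b p)
  update-known {u} {v} {b} {p} e k =
    set-known {v} {u} {b} {p [ u ]%= (_[ v ]≔ just b)} (trans (cl-sym v u) e) (set-known {p = p} e k)

  Holds : Fact n → Set
  Holds (u , v , b) = cl u v ≡ b

  initial-known : ∀ {l} → All Holds l → Known (initial l)
  initial-known []       u v {b} e with f ← trans (sym (trans (cong (λ r → lookup r v) (lookup∘tabulate _ u)) (lookup∘tabulate _ v))) e
    with yes refl ← u ≟ v = trans (cl-refl u) (just-injective f)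
  initial-known (_∷_ {xs = l} e es) = update-known {p = initial l} e (initial-known es)

  module _ (caps : List (Vec Bool n × ℕ)) (test : Matrix Bool n → Bool)
           (capped : All (λ (m , h) → ∀ u → count (λ v → lookup m v ∧ cl u v) ≤ h) caps) where

    withinCaps-complete : ∀ l → All (λ (m , h) → ∀ u → count (λ v → lookup m v ∧ cl u v) ≤ h) l →
                          ∀ {r u} → RowKnown r (cl u) → T (withinCaps caps test l r)
    withinCaps-complete []            []       k = tt
    withinCaps-complete ((m , h) ∷ l) (c ∷ cs) {r} {u} k =
      ∧-intro (≤⇒≤ᵇ (≤-trans (marked-≤ m r k) (c u))) (withinCaps-complete l cs k)

    viableRow-complete : ∀ b {p} → Known p → ∀ u → T (viableRow caps test b (lookup p u) p)
    viableRow-complete true  k u = withinCaps-complete caps capped (k u)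
    viableRow-complete false {p} k u =
      mayReach-complete (lookup p u) (lookup p u) p {g = cl} (k u) k (near u)

    -- A graph that satisfies the caps and has diameter at most two agrees with
    -- one branch of the search and is never abandoned there.
    search-sound : ∀ l {p} → Known p → T (search caps test l p) →
                   ∃[ M ] ((∀ u → lookup M u represents cl u) × T (test M))
    explore-sound : ∀ b u v l {p} → Known p → T (explore caps test b u v l p) →
                    ∃[ M ] ((∀ u → lookup M u represents cl u) × T (test M))
    search-sound [] {p} k t with just M ← decode p in eq = M , decode-sound p eq k , t
    search-sound ((u , v) ∷ l) {p} k t with lookup (lookup p u) v
    ... | just _ = search-sound l k t
    ... | nothing with cl u v in eq
    ...   | true  = explore-sound true  u v l (update-known {p = p} eq k) (∧-fst t)
    ...   | false = explore-sound false u v l (update-known {p = p} eq k)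
                      (∧-snd {explore caps test true u v l (update u v true p)} t)
    explore-sound b u v l {p} k t = ∨-elim {not (viable caps test b u v p)} t
      (λ s → ⊥-elim (T-not s (∧-intro (viableRow-complete b k u) (viableRow-complete b k v))))
      (search-sound l k)

-- The families of graphs to be searched

-- All pairs in lexicographic order.
pairs : ∀ n → List (Fin n × Fin n)
pairs n = filterᵇ (λ (u , v) → toℕ u <ᵇ toℕ v) (cartesianProduct (allFin n) (allFin n))

-- Colours for a vertex 0, its neighbours 1, ..., Δ and the other vertices.
star : ∀ {n} → ℕ → Fin n → Fin 3
star Δ zero    = 0F
star Δ (suc j) = if toℕ j <ᵇ Δ then 1F else 2F

-- Whether vertices of this colour lie in the closed neighbourhood of 0.
dominatedColour : Fin 3 → Bool
dominatedColour 2F = false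
dominatedColour _  = true

starFacts : ∀ n → ℕ → List (Fact n)
starFacts zero    Δ = []
starFacts (suc n) Δ = map (λ j → zero , j , dominatedColour (star Δ j)) (allFin (suc n))

everything : ∀ {n} → Vec Bool n
everything = replicate _ true

opaque
  -- The search started from a list of facts.
  succeeds : ∀ {n} → List (Vec Bool n × ℕ) → (Matrix Bool n → Bool) → List (Fin n × Fin n) → List (Fact n) → Bool
  succeeds caps test l facts = search caps test l (initial facts)

-- All graphs of order n and diameter at most two with maximum degree Δ,
-- attained at the vertex 0 with neighbours 1, ..., Δ, pass the test.
starSearch : ∀ n → ℕ → (Matrix Bool n → Bool) → Bool
starSearch n Δ test = succeeds ((everything , suc Δ) ∷ []) test (pairs n) (starFacts n Δ)

opaque
  -- The test for order six: Dominator can end the game within two moves, or the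
  -- graph is isomorphic to one of five given graphs.
  sixTest : (A B C D E M : Matrix Bool 6) → Bool
  sixTest A B C D E M = finish? M dominator 2 everything ∨ (isomorphic? M A ∨ (isomorphic? M B
    ∨ (isomorphic? M C ∨ (isomorphic? M D ∨ isomorphic? M E))))

  isoTest : ∀ {n} → Matrix Bool n → Matrix Bool n → Bool
  isoTest N M = isomorphic? M N

  finishTest : ∀ {n} → ℕ → Matrix Bool n → Bool
  finishTest k M = finish? M dominator k everything

-- A critical position of order ten: Dominator plays 0 with neighbours 1 to 4,
-- the only vertex newly dominated by Staller's reply s is 5, and 6 to 9 remain.
stuckFacts : Fin 10 → List (Fact 10)
stuckFacts s = map (λ j → 0F , j , (toℕ j ≤ᵇ 4)) (allFin 10)
  ++ (s , 5F , true) ∷ map (λ j → s , j , false) (6F ∷ 7F ∷ 8F ∷ 9F ∷ [])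

-- Deciding first the pairs that meet the four remaining vertices makes the
-- cap on them effective early.
stuckOrder : List (Fin 10 × Fin 10)
stuckOrder = pairsOf U U ++ pairsOf W U ++ pairsOf (5F ∷ []) U ++ pairsOf W (5F ∷ []) ++ pairsOf W W
  where
  U W : List (Fin 10)
  U = 6F ∷ 7F ∷ 8F ∷ 9F ∷ []
  W = 1F ∷ 2F ∷ 3F ∷ 4F ∷ []
  pairsOf : List (Fin 10) → List (Fin 10) → List (Fin 10 × Fin 10)
  pairsOf A B = filterᵇ (λ (u , v) → toℕ u <ᵇ toℕ v) (map swap (cartesianProduct B A))

lastFour : Vec Bool 10
lastFour = tabulate λ j → 6 ≤ᵇ toℕ j

-- Degrees are at most 4 and no vertex dominates three of the last four.
stuckSearch : Fin 10 → Bool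
stuckSearch s = succeeds ((everything , 5) ∷ (lastFour , 2) ∷ []) (finishTest 4) stuckOrder (stuckFacts s)

-- Edges between dominated and undominated vertices

module Crowd {n} (G : Graph n) where
  open Graph G
  open Game G
  open Strategy G

  -- Count the edges between the remaining set U and the set Y of dominated
  -- vertices other than the selected v and s, which have no neighbours in U.
  -- A vertex of U has at most h neighbours in U, hence at least m in Y, and a
  -- vertex of Y has at most h + 1 in U.
  crowd : ∀ {v s h m} (let U = full ⊖ v ⊖ s) → 0 < hits s (full ⊖ v) →
          (∀ z → hits z U ≤ suc h) → (∀ x → T (U x) → m + h ≤ deg x) →
          ∃[ y ] (n ≡ count U + (2 + y) × count U * m ≤ y * suc h)
  crowd {v} {s} {h} {m} 0<s bound degree = count Y , total , double-count adj lower upper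
    where
    U Y : State n
    U = full ⊖ v ⊖ s
    Y z = (not (U z) ∧ not (does (v ≟ z))) ∧ not (does (s ≟ z))

    v∌U : ∀ {x} → T (U x) → ¬ T (cl v x)
    v∌U {x} t = T-not (∧-fst {not (cl v x)} t)
    s∌U : ∀ {x} → T (U x) → ¬ T (cl s x)
    s∌U {x} t = T-not (∧-snd {not (cl v x)} t)

    total : n ≡ count U + (2 + count Y)
    total = trans (sym (count-all n)) (trans (count-split full U) (cong (count U +_)
      (trans (count-remove (λ z → not (U z)) v (not-T {U v} λ t → v∌U t (cl-refl v)))
        (cong suc (count-remove (λ z → not (U z) ∧ not (does (v ≟ z))) s
          (∧-intro {not (U s)} (not-T {U s} λ t → s∌U t (cl-refl s)) (not-T (fresh 0<s ∘ does-T (v ≟ s)))))))))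

    lower : ∀ x → T (U x) → m ≤ count (λ z → Y z ∧ adj z x)
    lower x t = ℕₚ.+-cancelʳ-≤ h _ _ (begin
      m + h                                           ≤⟨ degree x t ⟩
      deg x                                           ≡⟨ count-split (adj x) U ⟩
      count (λ z → adj x z ∧ U z) + count (λ z → adj x z ∧ not (U z))
                                                      ≤⟨ +-mono-≤ inside (count-mono outside) ⟩
      h + count (λ z → Y z ∧ adj z x)                 ≡⟨ ℕₚ.+-comm h _ ⟩
      count (λ z → Y z ∧ adj z x) + h                 ∎)
      where
      open ≤-Reasoning
      inside : count (λ z → adj x z ∧ U z) ≤ h
      inside = ℕₚ.≤-pred (≤-trans (s≤s (count-mono λ z u →
          ∧-intro {U z ∧ cl x z}
            (∧-intro {U z} (∧-snd {adj x z} u) (T-does (dominates? G x z) (inj₂ (does-T (x ~? z) (∧-fst u)))))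
            (not-T λ e → ~-irrefl (subst (x ~_) (sym (does-T (x ≟ z) e)) (does-T (x ~? z) (∧-fst u))))))
        (≤-trans (≤-reflexive (sym (count-remove (λ z → U z ∧ cl x z) x (∧-intro {U x} t (cl-refl x)))))
          (bound x)))
      outside : ∀ z → T (adj x z ∧ not (U z)) → T (Y z ∧ adj z x)
      outside z u = ∧-intro {Y z}
        (∧-intro {not (U z) ∧ not (does (v ≟ z))}
          (∧-intro {not (U z)} (∧-snd {adj x z} u) (not-T λ e → v∌U t (near-by (does-T (v ≟ z) e))))
          (not-T λ e → s∌U t (near-by (does-T (s ≟ z) e))))
        (T-does (z ~? x) z~x)
        where
        z~x : z ~ x
        z~x = ~-sym (does-T (x ~? z) (∧-fst u))
        near-by : ∀ {w} → w ≡ z → T (cl w x)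
        near-by refl = T-does (dominates? G z x) (inj₂ z~x)

    upper : ∀ z → T (Y z) → count (λ x → U x ∧ adj z x) ≤ suc h
    upper z _ = ≤-trans (count-mono λ x u → ∧-intro {U x} (∧-fst u)
      (T-does (dominates? G z x) (inj₂ (does-T (z ~? x) (∧-snd {U x} u))))) (bound z)

-- Reducing a graph to a searched family

-- All distances are at most 2.
Near : ∀ {n} → Graph n → Set
Near G = ∀ u v → u ≡ v ⊎ u ~ v ⊎ ∃[ w ] (u ~ w × w ~ v)
  where open Graph G

module Relabelled {m n} (π : Permutation m n) (G : Graph n) where

  G′ : Graph m
  G′ = relabel π G

  π-injective : ∀ {u v} → π ⟨$⟩ʳ u ≡ π ⟨$⟩ʳ v → u ≡ v
  π-injective = to-injective (relabel-≅ π G)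

  cl-relabel : ∀ u v → Game.cl G′ u v ≡ Game.cl G (π ⟨$⟩ʳ u) (π ⟨$⟩ʳ v)
  cl-relabel u v = T-ext
    (T-does (dominates? G _ _) ∘ dominates⁺ (relabel-≅ π G) ∘ does-T (dominates? G′ u v))
    (T-does (dominates? G′ u v) ∘ dominates⁻ (relabel-≅ π G) ∘ does-T (dominates? G _ _))

  near-relabel : Near G → Near G′
  near-relabel near u v with near (π ⟨$⟩ʳ u) (π ⟨$⟩ʳ v)
  ... | inj₁ e                  = inj₁ (π-injective e)
  ... | inj₂ (inj₁ a)           = inj₂ (inj₁ a)
  ... | inj₂ (inj₂ (w , a , b)) = inj₂ (inj₂ (π ⟨$⟩ˡ w
    , subst (Graph._~_ G _) (sym (inverseʳ π)) a , subst (λ x → Graph._~_ G x _) (sym (inverseʳ π)) b))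

  count-relabel : ∀ (f : Fin n → Bool) u →
    count (λ v → f (π ⟨$⟩ʳ v) ∧ Game.cl G′ u v) ≡ Game.hits G (π ⟨$⟩ʳ u) f
  count-relabel f u = trans (count-cong λ v → cong (f (π ⟨$⟩ʳ v) ∧_) (cl-relabel u v))
    (sym (count-permute (λ x → f x ∧ Game.cl G (π ⟨$⟩ʳ u) x) π))

  degree-capped : ∀ {Δ} → (∀ v → Strategy.deg G v ≤ Δ) →
    ∀ u → count (λ v → lookup everything v ∧ Game.cl G′ u v) ≤ suc Δ
  degree-capped {Δ} deg≤ u = subst (_≤ suc Δ)
    (trans (sym (Strategy.hits-full G (π ⟨$⟩ʳ u))) (trans (sym (count-relabel (λ _ → true) u))
      (count-cong λ v → cong (_∧ Game.cl G′ u v) (sym (lookup-replicate v true)))))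
    (s≤s (deg≤ (π ⟨$⟩ʳ u)))

module Searched {n} (G : Graph n) (near : Near G) where
  open Game G

  cl-symmetric : ∀ u v → cl u v ≡ cl v u
  cl-symmetric u v = T-ext (flip u v) (flip v u)
    where
    flip : ∀ u v → T (cl u v) → T (cl v u)
    flip u v t with does-T (dominates? G u v) t
    ... | inj₁ e = T-does (dominates? G v u) (inj₁ (sym e))
    ... | inj₂ a = T-does (dominates? G v u) (inj₂ (Graph.~-sym G a))

  cl-reflexive : ∀ u → cl u u ≡ true
  cl-reflexive u = T-ext (λ _ → tt) (λ _ → cl-refl u)

  cl-near : ∀ u v → ∃[ w ] (T (cl u w) × T (cl v w))
  cl-near u v =
    let w , d , e = Strategy.Near.common G near u v in
    w , subst T (cl-symmetric w u) (T-does (dominates? G w u) d)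
      , subst T (cl-symmetric w v) (T-does (dominates? G w v) e)

  open SearchSound cl cl-reflexive cl-symmetric cl-near public

  opaque
    unfolding succeeds

    succeeds-sound : ∀ {caps test l facts} →
      All (λ (m , h) → ∀ u → count (λ v → lookup m v ∧ cl u v) ≤ h) caps → All Holds facts →
      succeeds caps test l facts ≡ true →
      ∃[ M ] ((∀ u → lookup M u represents cl u) × T (test M))
    succeeds-sound {caps} {test} {l} capped facts ok =
      search-sound caps test capped l (initial-known facts) (subst T (sym ok) tt)

-- Some relabelling of G has a matrix that passes the test.
Found : ∀ {n} → Graph n → (Matrix Bool n → Bool) → Set₁
Found {n} G test = Σ (Graph n) λ G′ → G′ ≅ G ×
  ∃[ M ] ((∀ u → lookup M u represents Game.cl G′ u) × T (test M))

-- The class sizes of star when r vertices are not dominated by 0.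
starSizes : ℕ → ℕ → Fin 3 → ℕ
starSizes Δ r 0F = 1
starSizes Δ r 1F = Δ
starSizes Δ r 2F = r

module StarSearch {m} (G : Graph (suc m)) (near : Near G) (v₀ : Fin (suc m)) where
  open Graph G
  open Game G
  open Strategy G

  -- The colouring star, transported to G with v₀ in place of 0.
  colour : Fin (suc m) → Fin 3
  colour x = if does (v₀ ≟ x) then 0F else if adj v₀ x then 1F else 2F

  class-colour : ∀ a → class colour a ≡ starSizes (deg v₀) (count (full ⊖ v₀)) a
  class-colour 0F = trans (count-cong same) (count-≟ v₀)
    where
    same : ∀ x → does (0F ≟ colour x) ≡ does (v₀ ≟ x)
    same x with does (v₀ ≟ x) | adj v₀ x
    ... | true  | _     = refl
    ... | false | true  = refl
    ... | false | false = refl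
  class-colour 1F = count-cong same
    where
    same : ∀ x → does (1F ≟ colour x) ≡ adj v₀ x
    same x with v₀ ≟ x | v₀ ~? x
    ... | yes refl | yes a = ⊥-elim (~-irrefl a)
    ... | yes _    | no _  = refl
    ... | no _     | yes _ = refl
    ... | no _     | no _  = refl
  class-colour 2F = count-cong same
    where
    same : ∀ x → does (2F ≟ colour x) ≡ not (does (v₀ ≟ x) ∨ adj v₀ x)
    same x with does (v₀ ≟ x) | adj v₀ x
    ... | true  | _     = refl
    ... | false | true  = refl
    ... | false | false = refl

  colour-0 : ∀ {x} → colour x ≡ 0F → v₀ ≡ x
  colour-0 {x} e with v₀ ≟ x | adj v₀ x
  colour-0 e  | yes p | _ = p
  colour-0 () | no _  | true
  colour-0 () | no _  | false

  cl-colour : ∀ x → cl v₀ x ≡ dominatedColour (colour x)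
  cl-colour x with does (v₀ ≟ x) | adj v₀ x
  ... | true  | _     = refl
  ... | false | true  = refl
  ... | false | false = refl

  -- If Δ is the maximum degree, attained at v₀, then starSearch covers G.
  found : ∀ Δ r {test} → deg v₀ ≡ Δ → (∀ v → deg v ≤ Δ) → count (full ⊖ v₀) ≡ r →
          (∀ a → starSizes Δ r a ≡ class (star {suc m} Δ) a) →
          starSearch (suc m) Δ test ≡ true → Found G test
  found Δ r {test} refl deg≤ refl targets ok
    with π , recolour ← rearrange colour (star Δ) (λ a → trans (class-colour a) (targets a)) =
    G′ , relabel-≅ π G , succeeds-sound (degree-capped deg≤ ∷ []) facts ok
    where
    open Relabelled π G
    open Searched G′ (near-relabel near)
    v₀-first : v₀ ≡ π ⟨$⟩ʳ zero
    v₀-first = colour-0 (recolour zero)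
    facts : All Holds (starFacts (suc m) Δ)
    facts = All-map⁺ (All-tabulate⁺ λ j → trans (cl-relabel zero j)
      (trans (cong (λ v → cl v (π ⟨$⟩ʳ j)) (sym v₀-first))
        (trans (cl-colour (π ⟨$⟩ʳ j)) (cong dominatedColour (recolour j)))))

-- Critical positions of order ten

-- Colours for the labels of a critical position.  Colour 0 is the first move,
-- 1 the reply s, 2 the other neighbours of 0, 3 the vertex newly dominated by
-- s when it is not s itself, and 4 the remaining vertices.  The Boolean says
-- whether s is a neighbour of 0; it has label 1 if so, and label 5 if not.
stuckTarget : Bool → Fin 10 → Fin 5
stuckTarget b 0F = 0F
stuckTarget b 1F = if b then 1F else 2F
stuckTarget b 2F = 2F
stuckTarget b 3F = 2F
stuckTarget b 4F = 2F
stuckTarget b 5F = if b then 3F else 1F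
stuckTarget b _  = 4F

-- The colour of x, where p, q, b, c say that x is the first move, that x is s,
-- that the first move dominates x, and that s dominates x.
colourOf : Bool → Bool → Bool → Bool → Fin 5
colourOf p q b c = if p then 0F else if q then 1F else
                   if b then 2F else if c then 3F else 4F

-- The relations between these four properties of a vertex; a says whether the
-- first move dominates s.
valid : Bool → Bool → Bool → Bool → Bool → Bool
valid a p q b c = (not p ∨ b) ∧ ((not q ∨ c) ∧ ((not q ∨ (b == a)) ∧ not (p ∧ q)))

both : (Bool → Bool) → Bool
both f = f true ∧ f false

both-sound : ∀ f → T (both f) → ∀ b → T (f b)
both-sound f t true  = ∧-fst t
both-sound f t false = ∧-snd {f true} t

-- Whether f holds for all valid combinations of properties.
tautology : Bool → (Bool → Bool → Bool → Bool → Bool) → Bool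
tautology a f = both λ p → both λ q → both λ b → both λ c → not (valid a p q b c) ∨ f p q b c

tautology-sound : ∀ a f → T (tautology a f) → ∀ p q b c → T (valid a p q b c) → T (f p q b c)
tautology-sound a f t p q b c v = ∨-elim {not (valid a p q b c)}
  (both-sound (λ c → g p q b c)
    (both-sound (λ b → both λ c → g p q b c)
      (both-sound (λ q → both λ b → both λ c → g p q b c)
        (both-sound (λ p → both λ q → both λ b → both λ c → g p q b c) t p) q) b) c)
  (λ n → ⊥-elim (T-not n v)) (λ s → s)
  where
  g : Bool → Bool → Bool → Bool → Bool
  g p q b c = not (valid a p q b c) ∨ f p q b c

-- Whether vertices of this colour are dominated by the first move.
dominatedColour₅ : Bool → Fin 5 → Bool
dominatedColour₅ a 0F = true
dominatedColour₅ a 1F = a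
dominatedColour₅ a 2F = true
dominatedColour₅ a _  = false

sizes₅ : Bool → Fin 5 → ℕ
sizes₅ a 0F = 1
sizes₅ a 1F = 1
sizes₅ a 2F = if a then 3 else 4
sizes₅ a 3F = if a then 1 else 0
sizes₅ a 4F = 4

-- The label of the reply s.
label : Bool → Fin 10
label a = if a then 1F else 5F

opaque
  unfolding count

  class-target : ∀ a i → class (stuckTarget a) i ≡ sizes₅ a i
  class-target true  0F = refl
  class-target true  1F = refl
  class-target true  2F = refl
  class-target true  3F = refl
  class-target true  4F = refl
  class-target false 0F = refl
  class-target false 1F = refl
  class-target false 2F = refl
  class-target false 3F = refl
  class-target false 4F = refl

-- A critical position: the first move v₀ has maximum degree 4, the reply s
-- leaves four vertices, and no vertex hits more than two of them.
module StuckSearch (G : Graph 10) (near : Near G) (v₀ s : Fin 10)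
  (deg-v₀ : Strategy.deg G v₀ ≡ 4) (deg≤ : ∀ v → Strategy.deg G v ≤ 4)
  (size-U : count (Game._⊖_ G (Game._⊖_ G (λ _ → true) v₀) s) ≡ 4)
  (0<s : 0 < Game.hits G s (Game._⊖_ G (λ _ → true) v₀))
  (bound : ∀ v → Game.hits G v (Game._⊖_ G (Game._⊖_ G (λ _ → true) v₀) s) ≤ 2) where
  open Graph G
  open Game G
  open Strategy G

  U : State 10
  U = full ⊖ v₀ ⊖ s

  colour : Fin 10 → Fin 5
  colour x = colourOf (does (v₀ ≟ x)) (does (s ≟ x)) (cl v₀ x) (cl s x)

  hits-s : hits s (full ⊖ v₀) ≡ 1
  hits-s = ℕₚ.+-cancelʳ-≡ 4 _ _ (trans (cong (hits s (full ⊖ v₀) +_) (sym size-U))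
    (trans (sym (size-⊖ (full ⊖ v₀) s))
      (ℕₚ.+-cancelˡ-≡ 5 _ _ (trans (cong (λ d → suc (d + count (full ⊖ v₀))) (sym deg-v₀)) (sym (size-full v₀))))))

  module Case (a : Bool) (a≡ : cl v₀ s ≡ a) where

    -- In particular v₀ and s are distinct, because s hits something after v₀.
    valid-at : ∀ x → T (valid a (does (v₀ ≟ x)) (does (s ≟ x)) (cl v₀ x) (cl s x))
    valid-at x = ∧-intro {not p ∨ b} (imp p λ t → subst (T ∘ cl v₀) (does-T (v₀ ≟ x) t) (cl-refl v₀))
      (∧-intro {not q ∨ c} (imp q λ t → subst (T ∘ cl s) (does-T (s ≟ x) t) (cl-refl s))
        (∧-intro {not q ∨ (b == a)} (imp q λ t → ==-complete (trans (cong (cl v₀) (sym (does-T (s ≟ x) t))) a≡))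
          (not-T λ t → fresh 0<s (trans (does-T (v₀ ≟ x) (∧-fst t)) (sym (does-T (s ≟ x) (∧-snd {p} t)))))))
      where
      p q b c : Bool
      p = does (v₀ ≟ x)
      q = does (s ≟ x)
      b = cl v₀ x
      c = cl s x
      imp : ∀ d {e} → (T d → T e) → T (not d ∨ e)
      imp false f = tt
      imp true  f = f tt
      ==-complete : ∀ {d e} → d ≡ e → T (d == e)
      ==-complete {true}  refl = tt
      ==-complete {false} refl = tt

    pointwise : ∀ (f g : Bool → Bool → Bool → Bool → Bool) → T (tautology a (λ p q b c → f p q b c == g p q b c)) →
      ∀ x → f (does (v₀ ≟ x)) (does (s ≟ x)) (cl v₀ x) (cl s x) ≡ g (does (v₀ ≟ x)) (does (s ≟ x)) (cl v₀ x) (cl s x)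
    pointwise f g t x = ==-sound _ _ (tautology-sound a (λ p q b c → f p q b c == g p q b c) t _ _ _ _ (valid-at x))

    has : Fin 5 → Bool → Bool → Bool → Bool → Bool
    has i p q b c = does (i ≟ colourOf p q b c)

    coloured : ∀ i (f : Bool → Bool → Bool → Bool → Bool) → T (tautology a (λ p q b c → not (has i p q b c) ∨ f p q b c)) →
      ∀ x → colour x ≡ i → T (f (does (v₀ ≟ x)) (does (s ≟ x)) (cl v₀ x) (cl s x))
    coloured i f t x e = ∨-elim {not (does (i ≟ colour x))}
      (tautology-sound a (λ p q b c → not (has i p q b c) ∨ f p q b c) t _ _ _ _ (valid-at x))
      (λ n → ⊥-elim (T-not n (T-does (i ≟ colour x) (sym e)))) (λ u → u)

  open Case

  without-v₀ : count (λ x → cl v₀ x ∧ not (does (v₀ ≟ x))) ≡ 4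
  without-v₀ = ℕₚ.suc-injective (trans (sym (count-remove (cl v₀) v₀ (cl-refl v₀))) (trans (hits-full v₀) (cong suc deg-v₀)))

  class-colour : ∀ a → cl v₀ s ≡ a → ∀ i → class colour i ≡ sizes₅ a i
  class-colour true e 0F = trans (count-cong (pointwise true e (has true e 0F) (λ p q b c → p) tt)) (count-≟ v₀)
  class-colour true e 1F = trans (count-cong (pointwise true e (has true e 1F) (λ p q b c → q) tt)) (count-≟ s)
  class-colour true e 2F = trans (count-cong (pointwise true e (has true e 2F) (λ p q b c → (b ∧ not p) ∧ not q) tt))
    (ℕₚ.suc-injective (trans (sym (count-remove (λ x → cl v₀ x ∧ not (does (v₀ ≟ x))) s
      (∧-intro {cl v₀ s} (subst T (sym e) tt) (not-T (fresh 0<s ∘ does-T (v₀ ≟ s)))))) without-v₀))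
  class-colour true e 3F = trans (count-cong (pointwise true e (has true e 3F) (λ p q b c → not b ∧ c) tt)) hits-s
  class-colour true e 4F = trans (count-cong (pointwise true e (has true e 4F) (λ p q b c → not b ∧ not c) tt)) size-U
  class-colour false e 0F = trans (count-cong (pointwise false e (has false e 0F) (λ p q b c → p) tt)) (count-≟ v₀)
  class-colour false e 1F = trans (count-cong (pointwise false e (has false e 1F) (λ p q b c → q) tt)) (count-≟ s)
  class-colour false e 2F = trans (count-cong (pointwise false e (has false e 2F) (λ p q b c → b ∧ not p) tt)) without-v₀
  class-colour false e 3F = trans (count-cong (pointwise false e (has false e 3F) (λ p q b c → (not b ∧ c) ∧ not q) tt))
    (ℕₚ.suc-injective (trans (sym (count-remove (λ x → not (cl v₀ x) ∧ cl s x) s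
      (∧-intro {not (cl v₀ s)} (subst (T ∘ not) (sym e) tt) (cl-refl s)))) hits-s))
  class-colour false e 4F = trans (count-cong (pointwise false e (has false e 4F) (λ p q b c → not b ∧ not c) tt)) size-U

  cl-colour : ∀ a → cl v₀ s ≡ a → ∀ x → cl v₀ x ≡ dominatedColour₅ a (colour x)
  cl-colour true  e = pointwise true e (λ p q b c → b) (λ p q b c → dominatedColour₅ true (colourOf p q b c)) tt
  cl-colour false e = pointwise false e (λ p q b c → b) (λ p q b c → dominatedColour₅ false (colourOf p q b c)) tt

  found : ∀ a → cl v₀ s ≡ a → stuckSearch (label a) ≡ true → Found G (finishTest 4)
  found a e ok
    with π , recolour ← rearrange colour (stuckTarget a)
           (λ i → trans (class-colour a e i) (sym (class-target a i))) =
    G′ , relabel-≅ π G , succeeds-sound (degree-capped deg≤ ∷ last-capped ∷ [])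
      (++⁺ (All-map⁺ {f = λ j → 0F , j , (toℕ j ≤ᵇ 4)} (All-tabulate⁺ row₀))
        (s-five ∷ All-map⁺ {f = λ j → label a , j , false}
          (s-far 6F refl ∷ s-far 7F refl ∷ s-far 8F refl ∷ s-far 9F refl ∷ []))) ok
    where
    open Relabelled π G
    open Searched G′ (near-relabel near)
    seen : ∀ {u x} j → u ≡ π ⟨$⟩ʳ x → Game.cl G′ x j ≡ cl u (π ⟨$⟩ʳ j)
    seen {x = x} j refl = cl-relabel x j
    first : v₀ ≡ π ⟨$⟩ʳ 0F
    first = does-T (v₀ ≟ _) (pick a e)
      where
      pick : ∀ a → cl v₀ s ≡ a → T (does (v₀ ≟ (π ⟨$⟩ʳ 0F)))
      pick true  e = coloured true  e 0F (λ p q b c → p) tt _ (recolour 0F)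
      pick false e = coloured false e 0F (λ p q b c → p) tt _ (recolour 0F)
    second : s ≡ π ⟨$⟩ʳ label a
    second = does-T (s ≟ _) (pick a e recolour)
      where
      pick : ∀ a → cl v₀ s ≡ a → (∀ i → colour (π ⟨$⟩ʳ i) ≡ stuckTarget a i) → T (does (s ≟ (π ⟨$⟩ʳ label a)))
      pick true  e r = coloured true  e 1F (λ p q b c → q) tt _ (r 1F)
      pick false e r = coloured false e 1F (λ p q b c → q) tt _ (r 5F)
    row₀ : ∀ j → Game.cl G′ 0F j ≡ (toℕ j ≤ᵇ 4)
    row₀ j = trans (seen j first) (trans (cl-colour a e (π ⟨$⟩ʳ j)) (trans (cong (dominatedColour₅ a) (recolour j)) (target a j)))
      where
      target : ∀ a j → dominatedColour₅ a (stuckTarget a j) ≡ (toℕ j ≤ᵇ 4)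
      target true  = λ j → ==-sound _ _ (allB-sound (λ j → dominatedColour₅ true  (stuckTarget true  j) == (toℕ j ≤ᵇ 4)) tt j)
      target false = λ j → ==-sound _ _ (allB-sound (λ j → dominatedColour₅ false (stuckTarget false j) == (toℕ j ≤ᵇ 4)) tt j)
    s-five : Game.cl G′ (label a) 5F ≡ true
    s-five = trans (seen 5F second) (T-ext (λ _ → tt) λ _ → pick a e recolour)
      where
      pick : ∀ a → cl v₀ s ≡ a → (∀ i → colour (π ⟨$⟩ʳ i) ≡ stuckTarget a i) → T (cl s (π ⟨$⟩ʳ 5F))
      pick true  e r = coloured true  e 3F (λ p q b c → c) tt _ (r 5F)
      pick false e r = coloured false e 1F (λ p q b c → c) tt _ (r 5F)
    in-U : ∀ j → U (π ⟨$⟩ʳ j) ≡ does (4F ≟ stuckTarget a j)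
    in-U j = trans (pick a e) (cong (λ i → does (4F ≟ i)) (recolour j))
      where
      pick : ∀ a → cl v₀ s ≡ a → U (π ⟨$⟩ʳ j) ≡ does (4F ≟ colour (π ⟨$⟩ʳ j))
      pick true  e = pointwise true  e (λ p q b c → not b ∧ not c) (has true  e 4F) tt _
      pick false e = pointwise false e (λ p q b c → not b ∧ not c) (has false e 4F) tt _
    s-far : ∀ j → does (4F ≟ stuckTarget a j) ≡ true → Game.cl G′ (label a) j ≡ false
    s-far j t = trans (seen j second) (T-ext
      (λ u → T-not (∧-snd {not (cl v₀ (π ⟨$⟩ʳ j))} (subst T (sym (trans (in-U j) t)) tt)) u) λ ())
    last-capped : ∀ u → count (λ v → lookup lastFour v ∧ Game.cl G′ u v) ≤ 2
    last-capped u = subst (_≤ 2)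
      (trans (sym (count-relabel U u)) (count-cong λ v → cong (_∧ Game.cl G′ u v) (trans (in-U v) (target a v))))
      (bound (π ⟨$⟩ʳ u))
      where
      target : ∀ a j → does (4F ≟ stuckTarget a j) ≡ lookup lastFour j
      target true  = λ j → ==-sound _ _ (allB-sound (λ j → does (4F ≟ stuckTarget true  j) == lookup lastFour j) tt j)
      target false = λ j → ==-sound _ _ (allB-sound (λ j → does (4F ≟ stuckTarget false j) == lookup lastFour j) tt j)

-- Results of the searches

six : Matrix Bool 6 → Bool
six = sixTest (closedMatrix K₃,₃) (closedMatrix prism) (closedMatrix H₅) (closedMatrix H₆) (closedMatrix H₇)

opaque
  unfolding succeeds closedMatrix isoTest

  -- Each search covers, up to isomorphism, all graphs of the given order and
  -- maximum degree whose diameter is at most two.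
  search-4 : starSearch 4 2 (isoTest (closedMatrix C₄)) ≡ true
  search-4 = refl

  search-5 : starSearch 5 2 (isoTest (closedMatrix C₅)) ≡ true
  search-5 = refl

  search-6 : starSearch 6 3 six ≡ true
  search-6 = refl

  search-8 : starSearch 8 3 (finishTest 3) ≡ true
  search-8 = refl

  search-10 : starSearch 10 3 (isoTest (closedMatrix petersen)) ≡ true
  search-10 = refl

  -- In a critical position the reply s is either a neighbour of the first move
  -- or the vertex that it newly dominates.
  stuck-adjacent : stuckSearch 1F ≡ true
  stuck-adjacent = refl

  stuck-self : stuckSearch 5F ≡ true
  stuck-self = refl

stuck-search : ∀ a → stuckSearch (label a) ≡ true
stuck-search true  = stuck-adjacent
stuck-search false = stuck-self

-- The exceptional graphs

-- Exact values from optimal play of both sides, evaluated on the matrix of H.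
γg-exact : ∀ {n} (H : Graph n) k → finish? (closedMatrix H) dominator k everything ≡ true →
           force? (closedMatrix H) dominator k everything ≡ true → k ≤ n → γg H ≡ k
γg-exact {n} H k f g k≤n = ≤-antisym
  (Game.finish-sound H dominator k [] (finish?-sound dominator k everything (λ x → lookup-replicate x true) (subst T (sym f) tt)) n)
  (Game.force-sound H dominator k [] (force?-sound dominator k everything (λ x → lookup-replicate x true) (subst T (sym g) tt)) n k≤n)
  where open Reflect H (closedMatrix H) (closedMatrix-rep H)

-- An inequality between numerals, by evaluation.
≤! : ∀ {m n} {t : T (m ≤ᵇ n)} → m ≤ n
≤! {m} {n} {t} = ℕₚ.≤ᵇ⇒≤ m n t

≤ᵇ-absurd : ∀ m n {f : T (not (m ≤ᵇ n))} → ¬ m ≤ n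
≤ᵇ-absurd m n {f} l = T-not f (≤⇒≤ᵇ l)

opaque
  unfolding closedMatrix

  γg-C₄ : γg C₄ ≡ 2
  γg-C₄ = γg-exact C₄ 2 refl refl ≤!
  γg-C₅ : γg C₅ ≡ 3
  γg-C₅ = γg-exact C₅ 3 refl refl ≤!
  γg-K₃,₃ : γg K₃,₃ ≡ 3
  γg-K₃,₃ = γg-exact K₃,₃ 3 refl refl ≤!
  γg-prism : γg prism ≡ 3
  γg-prism = γg-exact prism 3 refl refl ≤!
  γg-H₅ : γg H₅ ≡ 3
  γg-H₅ = γg-exact H₅ 3 refl refl ≤!
  γg-H₆ : γg H₆ ≡ 3
  γg-H₆ = γg-exact H₆ 3 refl refl ≤!
  γg-H₇ : γg H₇ ≡ 3
  γg-H₇ = γg-exact H₇ 3 refl refl ≤!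
  γg-petersen : γg petersen ≡ 5
  γg-petersen = γg-exact petersen 5 refl refl ≤!

-- The eight graphs that attain the bound.
Exceptional : ∀ {n} → Graph n → Set
Exceptional G = G ≅ C₄ ⊎ G ≅ C₅ ⊎ G ≅ K₃,₃ ⊎ G ≅ prism ⊎ G ≅ H₅ ⊎ G ≅ H₆ ⊎ G ≅ H₇ ⊎ G ≅ petersen

attains : ∀ {m n} {G : Graph n} (H : Graph m) k → γg H ≡ k → k ≡ ⌈ m /2⌉ → G ≅ H → γg G ≡ ⌈ n /2⌉
attains H k value half i with refl ← ↔⇒≡ (_≅_.bijection i) = trans (γg-cong i) (trans value half)

exceptional⇒equality : ∀ {n} {G : Graph n} → Exceptional G → γg G ≡ ⌈ n /2⌉
exceptional⇒equality (inj₁ i) = attains C₄ 2 γg-C₄ refl i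
exceptional⇒equality (inj₂ (inj₁ i)) = attains C₅ 3 γg-C₅ refl i
exceptional⇒equality (inj₂ (inj₂ (inj₁ i))) = attains K₃,₃ 3 γg-K₃,₃ refl i
exceptional⇒equality (inj₂ (inj₂ (inj₂ (inj₁ i)))) = attains prism 3 γg-prism refl i
exceptional⇒equality (inj₂ (inj₂ (inj₂ (inj₂ (inj₁ i))))) = attains H₅ 3 γg-H₅ refl i
exceptional⇒equality (inj₂ (inj₂ (inj₂ (inj₂ (inj₂ (inj₁ i)))))) = attains H₆ 3 γg-H₆ refl i
exceptional⇒equality (inj₂ (inj₂ (inj₂ (inj₂ (inj₂ (inj₂ (inj₁ i))))))) = attains H₇ 3 γg-H₇ refl i
exceptional⇒equality (inj₂ (inj₂ (inj₂ (inj₂ (inj₂ (inj₂ (inj₂ i))))))) = attains petersen 5 γg-petersen refl i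

-- Graphs of diameter two

diameter⇒near : ∀ {n} (G : Graph n) → Diameter G 2 → Near G
diameter⇒near G (short , _) u v with short u v
... | _ , ([] , _) , _                = inj₁ refl
... | _ , (a ∷ [] , _) , _            = inj₂ (inj₁ a)
... | _ , (a ∷ b ∷ [] , _) , _        = inj₂ (inj₂ (_ , a , b))
... | _ , (_ ∷ _ ∷ _ ∷ _ , _) , s≤s (s≤s ())

diameter⇒degree : ∀ {n} (G : Graph n) → Diameter G 2 → ∃[ v ] 2 ≤ Strategy.deg G v
diameter⇒degree G (_ , u , v , (_∷_ {v = w} a (b ∷ []) , least)) =
  w , count≥2 {i = u} {v} (T-does (w ~? u) (~-sym a)) (T-does (w ~? v) b) u≢v
  where
  open Graph G
  u≢v : u ≢ v
  u≢v refl with () ← least 0 []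

-- A function on a nonempty finite set attains its maximum.
argmax : ∀ {n} (f : Fin (suc n) → ℕ) → ∃[ i ] (∀ j → f j ≤ f i)
argmax {zero}  f = zero , λ { zero → ≤-refl }
argmax {suc n} f with i , p ← argmax (f ∘ suc) | ℕₚ.≤-total (f zero) (f (suc i))
... | inj₁ q = suc i , λ { zero → q ; (suc j) → p j }
... | inj₂ q = zero , λ { zero → ≤-refl ; (suc j) → ≤-trans (p j) q }

-- The dichotomy that is proved: the bound is strict, or the graph is one of
-- the exceptions.
data Outcome {n} (G : Graph n) : Set where
  below       : γg G < ⌈ n /2⌉ → Outcome G
  exceptional : Exceptional G → Outcome G

finish⇒outcome : ∀ {n k} {G : Graph n} → Game.Finish G dominator k (λ _ → true) → k < ⌈ n /2⌉ → Outcome G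
finish⇒outcome {n} {k} {G} F k< = below (≤-trans (s≤s (Game.finish-sound G dominator k [] F n)) k<)

opaque
  unfolding isoTest

  found-finish : ∀ {n k} {G : Graph n} → Found G (finishTest k) → k < ⌈ n /2⌉ → Outcome G
  found-finish {n} {k} (G′ , i , M , rep , t) k< = below (subst (_< ⌈ n /2⌉) (γg-cong i)
    (≤-trans (s≤s (Game.finish-sound G′ dominator k []
      (Reflect.finish?-sound G′ M rep dominator k everything (λ x → lookup-replicate x true) t) n)) k<))

  found-iso : ∀ {n} {G H : Graph n} → Found G (isoTest (closedMatrix H)) → G ≅ H
  found-iso {H = H} (G′ , i , M , rep , t) =
    ≅-trans (≅-sym i) (isomorphic?-sound G′ H M (closedMatrix H) rep (closedMatrix-rep H) t)

  found-six : {G : Graph 6} → Found G six → Outcome G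
  found-six {G} (G′ , i , M , rep , t) =
    ∨-elim {finish? M dominator 2 everything} t (λ u → found-finish {k = 2} (G′ , i , M , rep , u) ≤!) λ t →
    ∨-elim {isomorphic? M (closedMatrix K₃,₃)} t (λ u → exceptional (inj₂ (inj₂ (inj₁ (iso K₃,₃ u))))) λ t →
    ∨-elim {isomorphic? M (closedMatrix prism)} t (λ u → exceptional (inj₂ (inj₂ (inj₂ (inj₁ (iso prism u)))))) λ t →
    ∨-elim {isomorphic? M (closedMatrix H₅)} t (λ u → exceptional (inj₂ (inj₂ (inj₂ (inj₂ (inj₁ (iso H₅ u))))))) λ t →
    ∨-elim {isomorphic? M (closedMatrix H₆)} t (λ u → exceptional (inj₂ (inj₂ (inj₂ (inj₂ (inj₂ (inj₁ (iso H₆ u)))))))) λ u →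
    exceptional (inj₂ (inj₂ (inj₂ (inj₂ (inj₂ (inj₂ (inj₁ (iso H₇ u))))))))
    where
    iso : ∀ H → T (isomorphic? M (closedMatrix H)) → G ≅ H
    iso H u = found-iso (G′ , i , M , rep , u)

opaque
  unfolding count

  -- The class sizes of the target colourings.
  star-4-2 : ∀ a → starSizes 2 1 a ≡ class (star {4} 2) a
  star-4-2 0F = refl
  star-4-2 1F = refl
  star-4-2 2F = refl
  star-5-2 : ∀ a → starSizes 2 2 a ≡ class (star {5} 2) a
  star-5-2 0F = refl
  star-5-2 1F = refl
  star-5-2 2F = refl
  star-6-3 : ∀ a → starSizes 3 2 a ≡ class (star {6} 3) a
  star-6-3 0F = refl
  star-6-3 1F = refl
  star-6-3 2F = refl
  star-8-3 : ∀ a → starSizes 3 4 a ≡ class (star {8} 3) a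
  star-8-3 0F = refl
  star-8-3 1F = refl
  star-8-3 2F = refl
  star-10-3 : ∀ a → starSizes 3 6 a ≡ class (star {10} 3) a
  star-10-3 0F = refl
  star-10-3 1F = refl
  star-10-3 2F = refl

-- The case distinction on the maximum degree

module Opening {n} (G : Graph n) (near : Near G) (v₀ : Fin n) where
  open Game G
  open Strategy G
  open Near near

  hits-v₀ : 0 < hits v₀ full
  hits-v₀ = subst (0 <_) (sym (hits-full v₀)) (s≤s z≤n)

  at-once : count (full ⊖ v₀) ≡ 0 → Finish dominator 1 full
  at-once e = inj₂ (v₀ , hits-v₀ , e)

  open-with : ∀ k → (∀ w → 0 < hits w (full ⊖ v₀) → Finish dominator k (full ⊖ v₀ ⊖ w)) →
              Finish dominator (2 + k) full
  open-with k F = inj₂ (v₀ , hits-v₀ , F)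

  open-size : ∀ k {r} → count (full ⊖ v₀) ≡ r → (∀ U → suc (count U) ≤ r → Finish dominator k U) →
              Finish dominator (2 + k) full
  open-size k refl F = open-with k λ w h → F _ (hit-drop (full ⊖ v₀) h)

  -- The reply w of Staller to the first move v₀ leaves four vertices of which no
  -- move hits three; the slow rate would take three moves to dominate them.
  Stuck : Fin n → Set
  Stuck w = 0 < hits w (full ⊖ v₀) × count (full ⊖ v₀ ⊖ w) ≡ 4 × (∀ v → hits v (full ⊖ v₀ ⊖ w) ≤ 2)

  stuck? : ∀ w → Dec (Stuck w)
  stuck? w = (0 <? hits w (full ⊖ v₀)) ×-dec ((count (full ⊖ v₀ ⊖ w) ℕₚ.≟ 4)
    ×-dec all? (λ v → hits v (full ⊖ v₀ ⊖ w) ≤? 2))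

  -- Unless Staller can reach a stuck position, two further moves suffice after
  -- any reply: four vertices are hit by three and one, fewer by the slow rate.
  five-left : count (full ⊖ v₀) ≡ 5 → Finish dominator 4 full ⊎ ∃[ w ] Stuck w
  five-left e with any? stuck?
  ... | yes p = inj₂ p
  ... | no ¬p = inj₁ (open-with 2 reply)
    where
    reply : ∀ w → 0 < hits w (full ⊖ v₀) → Finish dominator 2 (full ⊖ v₀ ⊖ w)
    reply w h with ℕₚ.m≤n⇒m<n∨m≡n (ℕₚ.≤-pred (subst (suc (count (full ⊖ v₀ ⊖ w)) ≤_) e (hit-drop (full ⊖ v₀) h)))
    ... | inj₁ (s≤s l) = rate 2 (full ⊖ v₀ ⊖ w) (≤-trans (+-mono-≤ l l) ≤!)
    ... | inj₂ four with large? 2 (full ⊖ v₀ ⊖ w)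
    ...   | inj₁ (v , t) = round {k = 0} (s≤s z≤n) t λ U′ l →
              ℕₚ.n≤0⇒n≡0 (ℕₚ.+-cancelˡ-≤ 4 _ _ (subst (4 + count U′ ≤_) four l))
    ...   | inj₂ small = ⊥-elim (¬p (w , h , four , small))

  -- In a stuck position every remaining vertex has degree at least 3, hence two
  -- neighbours among the y dominated vertices that are not selected.
  stuck-order : ∀ {w} → Stuck w → ∃[ y ] (n ≡ 6 + y × 8 ≤ y * 2)
  stuck-order {w} (h , four , small)
    with y , total , bound ← Crowd.crowd G {v₀} {w} {m = 2} h small
      (λ x t → subst (3 ≤_) (ℕₚ.*-identityʳ (deg x))
        (ℕₚ.≤-pred (subst (_≤ suc (deg x * 1)) four (spread {full ⊖ v₀ ⊖ w} small x t))))
    = y , trans total (cong (_+ (2 + y)) four) , subst (λ c → c * 2 ≤ y * 2) four bound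

  stuck⇒order≢9 : ∀ {w} → Stuck w → n ≢ 9
  stuck⇒order≢9 stuck n≡9 with y , total , l ← stuck-order stuck
                          with refl ← trans (sym n≡9) total = ≤ᵇ-absurd 8 6 l

  -- If Staller's reply leaves eight vertices, some move hits four of them:
  -- otherwise each has degree at least 4 and two neighbours among the four
  -- dominated vertices that are not selected, which together have at most 12.
  fourteen : n ≡ 14 → (∀ v → deg v ≤ 4) → count (full ⊖ v₀) ≡ 9 → Finish dominator 6 full
  fourteen n≡14 deg≤ e = open-with 4 reply
    where
    open Bounded 4 deg≤
    reply : ∀ w → 0 < hits w (full ⊖ v₀) → Finish dominator 4 (full ⊖ v₀ ⊖ w)
    reply w h with ℕₚ.m≤n⇒m<n∨m≡n (ℕₚ.≤-pred (subst (suc (count (full ⊖ v₀ ⊖ w)) ≤_) e (hit-drop (full ⊖ v₀) h)))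
    ... | inj₁ (s≤s l) = descend {2} ≤! ≤! 4 (full ⊖ v₀ ⊖ w) (ℕₚ.+-monoˡ-≤ 2 l)
    ... | inj₂ eight with large? 3 (full ⊖ v₀ ⊖ w)
    ...   | inj₁ (v , t) = round (s≤s z≤n) t λ U′ l →
              let c≤3 = ℕₚ.+-cancelˡ-≤ 5 _ 3 (subst (5 + count U′ ≤_) eight l) in
              rate 2 U′ (≤-trans (+-mono-≤ c≤3 c≤3) ≤!)
    ...   | inj₂ small
            with y , total , bound ← Crowd.crowd G {v₀} {w} {m = 2} h small (λ x t → ℕₚ.≮⇒≥ λ d≤3 →
                   ≤ᵇ-absurd 7 6 (≤-trans (ℕₚ.≤-pred (subst (_≤ suc (deg x * 2)) eight (spread {full ⊖ v₀ ⊖ w} small x t)))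
                     (ℕₚ.*-monoˡ-≤ 2 (ℕₚ.≤-pred d≤3))))
            with refl ← trans (sym n≡14) (trans total (cong (_+ (2 + y)) eight)) =
              ⊥-elim (≤ᵇ-absurd 16 12 (subst (λ c → c * 2 ≤ 12) eight bound))

parity : ∀ m → ∃[ j ] (m ≡ j * 2 ⊎ m ≡ suc (j * 2))
parity zero = 0 , inj₁ refl
parity (suc m) with parity m
... | j , inj₁ e = j , inj₂ (cong suc e)
... | j , inj₂ e = suc j , inj₁ (cong suc e)

⌊j*2/2⌋ : ∀ j → ⌊ j * 2 /2⌋ ≡ j
⌊j*2/2⌋ zero    = refl
⌊j*2/2⌋ (suc j) = cong suc (⌊j*2/2⌋ j)

⌊1+j*2/2⌋ : ∀ j → ⌊ suc (j * 2) /2⌋ ≡ j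
⌊1+j*2/2⌋ zero    = refl
⌊1+j*2/2⌋ (suc j) = cong suc (⌊1+j*2/2⌋ j)

shift : ∀ e {c r} → suc c ≤ r → c + (2 + e) ≤ suc (e + r)
shift e {c} l = ≤-trans (≤-reflexive (trans (ℕₚ.+-comm c (2 + e)) (cong suc (sym (ℕₚ.+-suc e c)))))
  (s≤s (ℕₚ.+-monoʳ-≤ e l))

module _ {n} (G : Graph n) (near : Near G) (v₀ : Fin n) where
  open Game G
  open Strategy G
  open Near near
  open Opening G near v₀

  outcome-degree-2 : ∀ r → deg v₀ ≡ 2 → (∀ v → deg v ≤ 2) → count (full ⊖ v₀) ≡ r →
                     n ≡ 3 + r → r ≤ 2 → Outcome G
  outcome-degree-2 0 d deg≤ e refl _ = finish⇒outcome {k = 1} {G} (at-once e) ≤!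
  outcome-degree-2 1 d deg≤ e refl _ =
    exceptional (inj₁ (found-iso {H = C₄} (StarSearch.found G near v₀ 2 1 d deg≤ e star-4-2 search-4)))
  outcome-degree-2 2 d deg≤ e refl _ =
    exceptional (inj₂ (inj₁ (found-iso {H = C₅} (StarSearch.found G near v₀ 2 2 d deg≤ e star-5-2 search-5))))
  outcome-degree-2 (suc (suc (suc _))) _ _ _ _ (s≤s (s≤s ()))

  outcome-degree-3 : ∀ r → deg v₀ ≡ 3 → (∀ v → deg v ≤ 3) → count (full ⊖ v₀) ≡ r →
                     n ≡ 4 + r → r ≤ 6 → Outcome G
  outcome-degree-3 0 d deg≤ e refl _ = finish⇒outcome {k = 1} {G} (at-once e) ≤!
  outcome-degree-3 1 d deg≤ e refl _ = finish⇒outcome {k = 2} {G}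
    (open-size 0 e λ { U (s≤s c) → ℕₚ.n≤0⇒n≡0 c }) ≤!
  outcome-degree-3 2 d deg≤ e refl _ = found-six (StarSearch.found G near v₀ 3 2 d deg≤ e star-6-3 search-6)
  outcome-degree-3 3 d deg≤ e refl _ = finish⇒outcome {k = 3} {G}
    (open-size 1 e λ { U (s≤s c) → rate 1 U (+-mono-≤ c c) }) ≤!
  outcome-degree-3 4 d deg≤ e refl _ =
    found-finish {k = 3} (StarSearch.found G near v₀ 3 4 d deg≤ e star-8-3 search-8) ≤!
  outcome-degree-3 5 d deg≤ e refl _ = [ (λ F → finish⇒outcome {k = 4} {G} F ≤!)
    , (λ (w , stuck) → ⊥-elim (stuck⇒order≢9 stuck refl)) ]′ (five-left e)
  outcome-degree-3 6 d deg≤ e refl _ =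
    exceptional (inj₂ (inj₂ (inj₂ (inj₂ (inj₂ (inj₂ (inj₂
      (found-iso {H = petersen} (StarSearch.found G near v₀ 3 6 d deg≤ e star-10-3 search-10)))))))))
  outcome-degree-3 (suc (suc (suc (suc (suc (suc (suc _))))))) _ _ _ _ (s≤s (s≤s (s≤s (s≤s (s≤s (s≤s ()))))))

  -- Here n = 5 + r.  The credit of descend suffices for even r and descend-odd
  -- for r of the form 3 + 4 i; this leaves r = 1, 5 and 9.
  outcome-degree-4 : ∀ r → deg v₀ ≡ 4 → (∀ v → deg v ≤ 4) → count (full ⊖ v₀) ≡ r →
                     n ≡ 5 + r → r ≤ 12 → Outcome G
  outcome-degree-4 r d deg≤ e n≡ r≤ with parity r
  ... | j , inj₁ refl = finish⇒outcome {k = 2 + j} {G}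
    (open-size j e λ U c → descend {2} ≤! ≤! j U (≤-trans (≤-reflexive (ℕₚ.+-comm (count U) 2)) (s≤s c)))
    (subst (λ n → 2 + j < ⌈ n /2⌉) (sym n≡) (s≤s (s≤s (s≤s (≤-reflexive (sym (⌊j*2/2⌋ j)))))))
    where open Bounded 4 deg≤
  ... | j , inj₂ refl with parity j
  ...   | i , inj₂ refl = finish⇒outcome {k = 3 + i * 2} {G}
    (open-size (1 + i * 2) e λ { U (s≤s c) → descend-odd ≤! i U (≤-trans c (≤-reflexive (odd i))) })
    (subst (λ n → 3 + i * 2 < ⌈ n /2⌉) (sym n≡) (s≤s (s≤s (s≤s (≤-reflexive (sym (⌊1+j*2/2⌋ (suc (i * 2)))))))))
    where
    open Bounded 4 deg≤
    odd : ∀ i → suc (i * 2) * 2 ≡ 2 + i * 4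
    odd = solve-∀
  outcome-degree-4 _ d deg≤ e refl r≤ | _ , inj₂ refl | 0 , inj₁ refl = finish⇒outcome {k = 2} {G}
    (open-size 0 e λ { U (s≤s c) → ℕₚ.n≤0⇒n≡0 c }) ≤!
  outcome-degree-4 _ d deg≤ e refl r≤ | _ , inj₂ refl | 1 , inj₁ refl =
    [ (λ F → finish⇒outcome {k = 4} {G} F ≤!)
    , (λ (w , h , four , small) → found-finish {k = 4}
        (StuckSearch.found G near v₀ w d deg≤ four h small (cl v₀ w) refl (stuck-search (cl v₀ w)))
        ≤!) ]′ (five-left e)
  outcome-degree-4 _ d deg≤ e refl r≤ | _ , inj₂ refl | 2 , inj₁ refl =
    finish⇒outcome {k = 6} {G} (fourteen refl deg≤ e) ≤!
  outcome-degree-4 _ d deg≤ e n≡ r≤ | _ , inj₂ refl | suc (suc (suc i)) , inj₁ refl =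
    ⊥-elim (≤ᵇ-absurd 13 12 (≤-trans (m≤m+n 13 _) r≤))

  -- The first move hits Δ - 2 vertices beyond three.  They pay for the credit
  -- Δ - 3 of descend and, with one to spare, make the bound strict.
  outcome-large-degree : ∀ e r → (∀ v → deg v ≤ 5 + e) → count (full ⊖ v₀) ≡ r →
                         n ≡ 6 + (e + r) → Outcome G
  outcome-large-degree e r deg≤ r≡ n≡ with parity (e + r)
  ... | j , inj₁ p = finish⇒outcome {k = 2 + j} {G}
    (open-size j r≡ λ U c → descend (m≤m+n 2 e) ≤-refl j U
      (≤-trans (shift e c) (s≤s (≤-reflexive p))))
    (subst (λ n → 2 + j < ⌈ n /2⌉) (sym (trans n≡ (cong (6 +_) p))) (s≤s (s≤s (s≤s (≤-reflexive (sym (⌊1+j*2/2⌋ j)))))))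
    where open Bounded (5 + e) deg≤
  ... | j , inj₂ p = finish⇒outcome {k = 3 + j} {G}
    (open-size (suc j) r≡ λ U c → descend (m≤m+n 2 e) ≤-refl (suc j) U
      (≤-trans (shift e c) (≤-trans (s≤s (≤-reflexive p)) (ℕₚ.n≤1+n _))))
    (subst (λ n → 3 + j < ⌈ n /2⌉) (sym (trans n≡ (cong (6 +_) p))) (s≤s (s≤s (s≤s (s≤s (≤-reflexive (sym (⌊j*2/2⌋ j))))))))
    where open Bounded (5 + e) deg≤

  outcome-by-degree : ∀ Δ → deg v₀ ≡ Δ → (∀ v → deg v ≤ Δ) → 2 ≤ Δ → Outcome G
  outcome-by-degree Δ d deg≤ 2≤Δ = split Δ d deg≤ 2≤Δ size room
    where
    r : ℕ
    r = count (full ⊖ v₀)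
    size : n ≡ suc (Δ + r)
    size = trans (size-full v₀) (cong (λ d → suc (d + r)) d)
    room : Δ + r ≤ Δ * Δ
    room = ℕₚ.≤-pred (subst₂ (λ n d → n ≤ suc (d * Δ)) size d (Bounded.moore Δ deg≤ v₀))
    split : ∀ Δ → deg v₀ ≡ Δ → (∀ v → deg v ≤ Δ) → 2 ≤ Δ → n ≡ suc (Δ + r) → Δ + r ≤ Δ * Δ → Outcome G
    split 2 d deg≤ _ n≡ l = outcome-degree-2 r d deg≤ refl n≡ (ℕₚ.+-cancelˡ-≤ 2 _ _ l)
    split 3 d deg≤ _ n≡ l = outcome-degree-3 r d deg≤ refl n≡ (ℕₚ.+-cancelˡ-≤ 3 _ _ l)
    split 4 d deg≤ _ n≡ l = outcome-degree-4 r d deg≤ refl n≡ (ℕₚ.+-cancelˡ-≤ 4 _ _ l)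
    split (suc (suc (suc (suc (suc e))))) d deg≤ _ n≡ l = outcome-large-degree e r deg≤ refl n≡
    split 1 _ _ (s≤s ()) _ _

outcome : ∀ {n} (G : Graph n) → Diameter G 2 → Outcome G
outcome {zero} G diameter with () ← proj₁ (diameter⇒degree G diameter)
outcome {suc n} G diameter
  with v₀ , greatest ← argmax (Strategy.deg G) | w , 2≤ ← diameter⇒degree G diameter =
  outcome-by-degree G (diameter⇒near G diameter) v₀ _ refl greatest (≤-trans 2≤ (greatest w))

theorem3p1 : ∀ (n : ℕ) (G : Graph n) → Diameter G 2 →
    (γg G ≤ ⌈ n /2⌉) ×
    (γg G ≡ ⌈ n /2⌉ ⇔
    (G ≅ C₄ ⊎ G ≅ C₅ ⊎ G ≅ K₃,₃ ⊎ G ≅ prism ⊎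
    G ≅ H₅ ⊎ G ≅ H₆ ⊎ G ≅ H₇ ⊎ G ≅ petersen))
theorem3p1 n G diameter with outcome G diameter
... | below l = ℕₚ.<⇒≤ l , mk⇔ (λ e → ⊥-elim (ℕₚ.<⇒≢ l e)) exceptional⇒equality
... | exceptional x = ≤-reflexive (exceptional⇒equality x) , mk⇔ (λ _ → x) exceptional⇒equality
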